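{- For each integer $p>1$, the incidence structure $\mathscr{D}^3_p=\mathscr{D}(B,G)$ defined in the context is a $2$-$(v,k,\lambda)$ design with $v=p^8+p^4+1$ and $k=p^4+1$, for some $\lambda$, and $G$ is a $3$-grid-imprimitive group of automorphisms of it that is transitive on blocks.
   Context: Let $e_1=p^2+p+1$, $e_2=p^2-p+1$, $e_3=p^4-p^2+1$, and $\mathcal{P}=\mathbb{Z}_{e_1}\times\mathbb{Z}_{e_2}\times\mathbb{Z}_{e_3}$, where elements of $\mathbb{Z}_{e}$ are represented by $0,1,\dots,e-1$. Let $G=\mathrm{Sym}(\mathbb{Z}_{e_1})\times\mathrm{Sym}(\mathbb{Z}_{e_2})\times\mathrm{Sym}(\mathbb{Z}_{e_3})$ act coordinatewise on $\mathcal{P}$. For $B\subseteq\mathcal{P}$, $\mathscr{D}(B,G)$ is the incidence structure with point set $\mathcal{P}$ and block set $\{B^g : g\in G\}$. A $2$-$(v,k,\lambda)$ design has $v$ points, blocks of size $k$, and every pair of distinct points in exactly $\lambda$ blocks. A permutation group on $\mathcal{P}$ is $3$-grid-imprimitive if $\mathcal{P}$ can be identified with a Cartesian product of three sets of size $>1$ such that the group is contained in the direct product of the three symmetric groups acting coordinatewise. Write $n=\frac{p^2-p}{2}$. The set $B$ is $B=(B'\times\{0\})\cup B_3$, where $B'\subseteq\mathbb{Z}_{e_1}\times\mathbb{Z}_{e_2}$ consists of the points $(a,0)$ for $0\le a\le p$, together with $(p+a,2a-1)$ and $(p+a,2a)$ for $1\le a\le n$, and $B_3\subseteq\mathcal{P}$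 is as follows. If $p=2$: $B_3=\{(3+a,b,c-1),(3+a,b,c) : 1\le a\le3,\ 1\le b\le2,\ c=2(a+3(b-1))\}$. If $p>2$: $B_3=B_{3,1}\cup B_{3,2}\cup B_{3,3}\cup B_{3,4}$. Set $m=\frac{p^2-1}{2}$ and $m'=\frac{p^2-2p+1}{2}$ if $p$ is odd, and $m=\frac{p^2-2p}{2}$ and $m'=\frac{p^2}{2}$ if $p$ is even. Then: $B_{3,1}$ consists of the points $(a,b,c-1)$ and $(a,b,c)$ for $1\le a\le p$, $1\le b\le m$, $c=2(a+(b-1)p)$. $B_{3,2}$ consists of the points $(p+a,b+\delta,c-1)$ and $(p+a,b+\delta,c)$ for $1\le a\le n$, $1\le b\le n$, $c=2pm+2(a+(b-1)n)$, where $\delta=n$ if $1\le a\le\lfloor\frac{p^2-p+2}{4}\rfloor$ and $b\in\{2a-1,2a\}$, and $\delta=0$ otherwise. $B_{3,3}$ consists of the points $(\frac{p^2+p}{2}+a,\,m+b,\,c-1)$ and $(\frac{p^2+p}{2}+a,\,m+b,\,c)$ for $1\le a\le p$, $1\le b\le m'$, $c=2c_0+2(a+(b-1)p)$, where $c_0=\frac{p^4+p^2-2p}{4}$ if $p$ is odd and $c_0=\frac{p^4-3p^2}{4}$ if $p$ is even. $B_{3,4}$ consists of the points $(\frac{p^2+3p}{2}+a,\,b+\delta,\,c-1)$ and $(\frac{p^2+3p}{2}+a,\,b+\delta,\,c)$ for $1\le a\le n$, $1\le b\le n$, $c=2\cdot\frac{p^4+2p^3-3p^2}{4}+2(a+(b-1)n)$,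 where $\delta=0$ if $a=1$ and $\delta=n$ otherwise. -}

module Defs where

open import Data.Bool.Base using (if_then_else_)
open import Data.Fin.Base using (Fin; toℕ)
open import Data.Nat.Base using (ℕ; _+_; _*_; _∸_; _^_; _/_; _≤_; _<_)
open import Data.Nat.Divisibility using (_∣?_)
open import Data.Nat.Properties using (_≟_; _≤?_)
open import Data.Product.Base using (_×_; _,_; ∃; ∃₂; Σ-syntax; proj₁)
open import Data.Product.Function.NonDependent.Propositional using (_×-↔_)
open import Data.Sum.Base using (_⊎_)
open import Function.Bundles using (Inverse; _↔_; _⇔_)
open import Function.Construct.Composition using (_↔-∘_)
open import Function.Construct.Identity using (↔-id)
open import Function.Construct.Symmetry using (↔-sym)
open import Level using (0ℓ; _⊔_)
open import Relation.Binary.Bundles using (Setoid)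
import Relation.Binary.Construct.On as On
open import Relation.Binary.Definitions using (_Respects_)
open import Relation.Binary.PropositionalEquality
  using (_≡_; _≢_; _≗_; refl; sym; trans; cong; setoid)
open import Relation.Nullary.Decidable using (does; _×-dec_; _⊎-dec_)
open import Relation.Unary using (Pred; _∈_; _≐_; _∪_)
open import Relation.Unary.Properties using (≐-sym; ≐-trans)
open import Relation.Unary.Relation.Binary.Equality using (≐-setoid)

open Inverse using (to; from)

-- Elements of a subset, compared as elements of the ambient set: proofs
-- of membership do not count.
subsetoid : ∀ {a ℓ q} (S : Setoid a ℓ) → Pred (Setoid.Carrier S) q →
            Setoid (a ⊔ q) ℓ
subsetoid S Q = On.setoid S (proj₁ {B = Q})

HasCardinality : ∀ {a ℓ} → Setoid a ℓ → ℕ → Set (a ⊔ ℓ)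
HasCardinality S n = Inverse (setoid (Fin n)) S

record PermutationGroup (Ω : Set) : Set₁ where
  field
    Member   : Pred (Ω ↔ Ω) 0ℓ
    resp     : ∀ {g h} → to g ≗ to h → Member g → Member h
    id-mem   : Member (↔-id Ω)
    ∘-mem    : ∀ {g h} → Member g → Member h → Member (g ↔-∘ h)
    sym-mem  : ∀ {g} → Member g → Member (↔-sym g)

open PermutationGroup using (Member)

from-cong : {Ω : Set} (g h : Ω ↔ Ω) → to g ≗ to h → from g ≗ from h
from-cong g h g≗h x =
  trans (cong (from g) (sym (trans (g≗h _) (Inverse.strictlyInverseˡ h x))))
        (Inverse.strictlyInverseʳ g _)

coordinatewise : {A B C : Set} → A ↔ A → B ↔ B → C ↔ C → (A × B × C) ↔ (A × B × C)
coordinatewise σ τ υ = σ ×-↔ (τ ×-↔ υ)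

-- Sym(A) × Sym(B) × Sym(C) as a subgroup of Sym(A × B × C).
Sym³ : (A B C : Set) → PermutationGroup (A × B × C)
Sym³ A B C = record
  { Member  = λ g → Σ[ σ ∈ A ↔ A ] Σ[ τ ∈ B ↔ B ] Σ[ υ ∈ C ↔ C ]
                      to g ≗ to (coordinatewise σ τ υ)
  ; resp    = λ { g≗h (σ , τ , υ , eq) → σ , τ , υ , λ x → trans (sym (g≗h x)) (eq x) }
  ; id-mem  = ↔-id A , ↔-id B , ↔-id C , λ _ → refl
  ; ∘-mem   = λ { {g} {h} (σ , τ , υ , eq) (σ′ , τ′ , υ′ , eq′) →
                  (σ ↔-∘ σ′) , (τ ↔-∘ τ′) , (υ ↔-∘ υ′) ,
                  λ x → trans (cong (to g) (eq′ x)) (eq _) }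
  ; sym-mem = λ { {g} (σ , τ , υ , eq) →
                  ↔-sym σ , ↔-sym τ , ↔-sym υ , from-cong g (coordinatewise σ τ υ) eq }
  }

GridImprimitive₃ : {Ω : Set} → PermutationGroup Ω → Set₁
GridImprimitive₃ {Ω} G =
  Σ[ A ∈ Set ] Σ[ B ∈ Set ] Σ[ C ∈ Set ]
    MoreThanOne A × MoreThanOne B × MoreThanOne C ×
    (Σ[ φ ∈ Ω ↔ (A × B × C) ]
      (∀ g → g ∈ Member G → (φ ↔-∘ (g ↔-∘ ↔-sym φ)) ∈ Member (Sym³ A B C)))
  where
  MoreThanOne : Set → Set
  MoreThanOne X = ∃₂ λ (x y : X) → x ≢ y

image : {Ω : Set} → Ω ↔ Ω → Pred Ω 0ℓ → Pred Ω 0ℓ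
image g X y = ∃ λ x → x ∈ X × to g x ≡ y

-- Blocks are subsets of the point set, identified when extensionally
-- equal, so that there are no repeated blocks.
record IncidenceStructure : Set₁ where
  field
    Point   : Set
    Block   : Pred (Pred Point 0ℓ) 0ℓ
    resp-≐  : Block Respects _≐_

  blocksThrough : Point → Point → Setoid _ _
  blocksThrough x y =
    subsetoid (≐-setoid Point 0ℓ) (λ X → X ∈ Block × x ∈ X × y ∈ X)

  IsAutomorphism : Point ↔ Point → Set₁
  IsAutomorphism g = ∀ X → X ∈ Block ⇔ image g X ∈ Block

record Is2Design (D : IncidenceStructure) (v k ƛ : ℕ) : Set₁ where
  open IncidenceStructure D
  field
    points : HasCardinality (setoid Point) v
    blocks : ∀ X → X ∈ Block → HasCardinality (subsetoid (setoid Point) X) k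
    pairs  : ∀ x y → x ≢ y → HasCardinality (blocksThrough x y) ƛ

module _ (D : IncidenceStructure) (G : PermutationGroup (IncidenceStructure.Point D)) where
  open IncidenceStructure D

  IsAutomorphismGroup : Set₁
  IsAutomorphismGroup = ∀ g → g ∈ Member G → IsAutomorphism g

  BlockTransitive : Set₁
  BlockTransitive = ∀ X Y → X ∈ Block → Y ∈ Block → ∃ λ g → g ∈ Member G × image g X ≐ Y

𝒟 : {Ω : Set} → Pred Ω 0ℓ → PermutationGroup Ω → IncidenceStructure
𝒟 {Ω} B G = record
  { Point  = Ω
  ; Block  = λ X → ∃ λ g → g ∈ Member G × X ≐ image g B
  ; resp-≐ = λ { X≐Y (g , g∈G , X≐Bᵍ) → g , g∈G , ≐-trans (≐-sym X≐Y) X≐Bᵍ }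
  }

-- All truncated subtractions and all divisions below
-- are exact wherever the formulas are used, except in the threshold of
-- δ₂, where a floor is intended.

e₁ e₂ e₃ : ℕ → ℕ
e₁ p = p ^ 2 + p + 1
e₂ p = p ^ 2 ∸ p + 1
e₃ p = p ^ 4 ∸ p ^ 2 + 1

Points : ℕ → Set
Points p = Fin (e₁ p) × Fin (e₂ p) × Fin (e₃ p)

G : (p : ℕ) → PermutationGroup (Points p)
G p = Sym³ (Fin (e₁ p)) (Fin (e₂ p)) (Fin (e₃ p))

module BaseBlock (p : ℕ) where

  n m m′ c₀ : ℕ
  n  = (p ^ 2 ∸ p) / 2
  m  = if does (2 ∣? p) then (p ^ 2 ∸ 2 * p) / 2 else (p ^ 2 ∸ 1) / 2
  m′ = if does (2 ∣? p) then p ^ 2 / 2 else (p ^ 2 ∸ 2 * p + 1) / 2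
  c₀ = if does (2 ∣? p) then (p ^ 4 ∸ 3 * p ^ 2) / 4 else (p ^ 4 + p ^ 2 ∸ 2 * p) / 4

  δ₂ δ₄ : ℕ → ℕ → ℕ
  δ₂ a b = if does (a ≤? (p ^ 2 ∸ p + 2) / 4 ×-dec (b ≟ 2 * a ∸ 1 ⊎-dec b ≟ 2 * a))
           then n else 0
  δ₄ a b = if does (a ≟ 1) then 0 else n

  _∈[1,_] : ℕ → ℕ → Set
  a ∈[1, k ] = 1 ≤ a × a ≤ k

  Twins : ℕ → ℕ → ℕ → Pred (ℕ × ℕ × ℕ) 0ℓ
  Twins x y c t = t ≡ (x , y , c ∸ 1) ⊎ t ≡ (x , y , c)

  Grid : ℕ → ℕ → (x y c : ℕ → ℕ → ℕ) → Pred (ℕ × ℕ × ℕ) 0ℓ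
  Grid k l x y c t =
    ∃₂ λ a b → a ∈[1, k ] × b ∈[1, l ] × t ∈ Twins (x a b) (y a b) (c a b)

  B′ : Pred (ℕ × ℕ) 0ℓ
  B′ s = (∃ λ a → a ≤ p × s ≡ (a , 0))
       ⊎ (∃ λ a → a ∈[1, n ] × (s ≡ (p + a , 2 * a ∸ 1) ⊎ s ≡ (p + a , 2 * a)))

  B′×0 : Pred (ℕ × ℕ × ℕ) 0ℓ
  B′×0 (x , y , z) = (x , y) ∈ B′ × z ≡ 0

  B₃[p=2] B₃₁ B₃₂ B₃₃ B₃₄ B₃ Bℕ : Pred (ℕ × ℕ × ℕ) 0ℓ

  B₃[p=2] = Grid 3 2 (λ a b → 3 + a) (λ a b → b) (λ a b → 2 * (a + 3 * (b ∸ 1)))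

  B₃₁ = Grid p m
    (λ a b → a)
    (λ a b → b)
    (λ a b → 2 * (a + (b ∸ 1) * p))

  B₃₂ = Grid n n
    (λ a b → p + a)
    (λ a b → b + δ₂ a b)
    (λ a b → 2 * p * m + 2 * (a + (b ∸ 1) * n))

  B₃₃ = Grid p m′
    (λ a b → (p ^ 2 + p) / 2 + a)
    (λ a b → m + b)
    (λ a b → 2 * c₀ + 2 * (a + (b ∸ 1) * p))

  B₃₄ = Grid n n
    (λ a b → (p ^ 2 + 3 * p) / 2 + a)
    (λ a b → b + δ₄ a b)
    (λ a b → 2 * ((p ^ 4 + 2 * p ^ 3 ∸ 3 * p ^ 2) / 4) + 2 * (a + (b ∸ 1) * n))

  B₃ t = (p ≡ 2 × t ∈ B₃[p=2])
       ⊎ (2 < p × t ∈ B₃₁ ∪ B₃₂ ∪ B₃₃ ∪ B₃₄)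

  Bℕ = B′×0 ∪ B₃

  -- Elements of ℤₑ are represented by 0, …, e - 1; every triple in Bℕ lies
  -- in this range when p > 1.
  B : Pred (Points p) 0ℓ
  B (x , y , z) = (toℕ x , toℕ y , toℕ z) ∈ Bℕ

𝒟³ : ℕ → IncidenceStructure
𝒟³ p = 𝒟 (BaseBlock.B p) (G p)

{-# OPTIONS --safe #-}

-- Here k(k − 1) = v − 1 = p⁴(p⁴ + 1).  For a set A of coordinates, double counting the blocks together
-- with an ordered pair of their points that agree exactly in A gives
--   (number of blocks) · (such pairs in B) = v · (such neighbours of a point) · (blocks through a pair),
-- because G is transitive on the pairs of points with a given agreement.  So 𝒟(B, G) is a 2-design as soon
-- as B has, for each A other than the full set, ∏ (eⱼ − 1) pairs (product over j ∉ A) that agree exactly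
-- in A, and then λ = (number of blocks)/v.
-- By inclusion–exclusion it is equivalent that p⁴ + ∏ eⱼ (over j ∉ A) pairs, equal ones included, agree
-- at least in A.  This is checked by grouping the points of B by their first and second coordinates:
-- outside the plane z = 0 the points come in pairs differing only in z, and no z occurs twice.
module Submission where

open import Algebra.Properties.Semiring.Sum as Semiring-Sum using ()
open import Data.Bool.Base using (Bool; true; false; if_then_else_; not; _∧_)
import Data.Bool.Properties as Boolₚ
open import Data.Fin.Base as Fin using (Fin; zero; suc; toℕ; fromℕ<; finToFun; funToFin)
open import Data.Fin.Induction using (<-wellFounded)
open import Data.Fin.Permutation using (↔⇒≡; transpose)
import Data.Fin.Permutation.Components as PC
import Data.Fin.Properties as Finₚ
open import Data.Nat.Base
open import Data.Nat.Divisibility using (_∣_; _∣?_; ∣⇒≤; ∣m+n∣m⇒∣n; m∣m*n)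
open import Data.Nat.DivMod using (m*n/n≡m; /-monoˡ-≤)
open import Data.Nat.Properties
open import Algebra.Properties.CommutativeSemigroup +-commutativeSemigroup using (interchange)
open import Data.Nat.Tactic.RingSolver using (solve-∀)
open import Data.Product.Base using (_×_; _,_; ∃; ∃₂; Σ; proj₁; proj₂)
open import Data.Product.Function.NonDependent.Propositional using (_×-↔_)
open import Data.Product.Properties using (≡-dec)
open import Data.Sum.Base using (_⊎_; inj₁; inj₂)
open import Data.Sum.Function.Propositional using (_⊎-↔_)
import Data.Sum.Properties as Sumₚ
open import Function.Base using (_∘_; id)
open import Function.Bundles
open import Function.Consequences using (strictlySurjective⇒surjective)
open import Function.Construct.Composition as Composition using (_↔-∘_)
open import Function.Construct.Identity using (↔-id)
open import Function.Construct.Symmetry as Symmetry using (↔-sym)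
open import Function.Definitions using (Congruent; Injective; StrictlySurjective)
open import Function.Properties.Bijection using (Bijection⇒Inverse)
open import Function.Properties.Inverse using (Inverse⇒Injection)
open import Induction.WellFounded using (Acc; acc)
open import Level using (Level; 0ℓ)
open import Relation.Binary.Bundles using (Setoid)
open import Relation.Binary.Definitions using (DecidableEquality; tri<; tri≈; tri>)
open import Relation.Binary.PropositionalEquality
open import Relation.Nullary.Decidable
  using (Dec; yes; no; does; does-⇔; dec-true; dec-false; ¬?; map′; _×-dec_; _⊎-dec_; _→-dec_)
open import Relation.Nullary.Negation using (¬_; contradiction)
open import Relation.Unary using (Pred; Decidable; _∈_; _⊆_; _≐_)
open import Relation.Unary.Properties using (≐-refl; ≐-sym; ≐-trans)
open import Defs

open PermutationGroup using (Member)
open ≡-Reasoning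

-- Sums over finite types

-- The excess p⁴ is k - 1: the products ∏ (eⱼ - 1) for all sets containing A add up to ∏ eⱼ, except
-- that the full set contributes k pairs instead of 1. The twins serve the pairs that agree in x and
-- y but not in z: e₃ - 1 of these are needed, and (e₃ - 1)/2 pairs of twins supply exactly them.
-- Seven of the eight counts follow from p² = p + 2n and m + m′ = 2n. The remaining one, over
-- columns, is a sum of squares of column sizes and fixes m and m′: 1 + 2m and 2m′ have to be p² and
-- (p - 1)², and as 1 + 2m is odd, the parity of p decides which is which. The obstacle on the side
-- of the design is that a block is a predicate up to extensional equality, while λ has to be an
-- actual cardinality. Group elements are therefore listed, with repetitions, and a block is
-- represented by the first element of the list that yields it. λ is never evaluated; double
-- counting only identifies it with the same quotient for every type of pair.

private variable
  a ℓ : Level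
  P Q : Set a

module Σₙ = Semiring-Sum +-*-semiring

infixr 6 _⊕_
infixr 7 _⊗_

-- Base blocks are indexed by types of this shape: sums over them split along the families of
-- points, and `enumeration` orders them, which is where the coordinates come from.
data Code : Set where
  fin     : ℕ → Code
  _⊕_ _⊗_ : Code → Code → Code

El : Code → Set
El (fin n) = Fin n
El (c ⊕ d) = El c ⊎ El d
El (c ⊗ d) = El c × El d

size : Code → ℕ
size (fin n) = n
size (c ⊕ d) = size c + size d
size (c ⊗ d) = size c * size d

_≟ᴱ_ : ∀ {c} → DecidableEquality (El c)
_≟ᴱ_ {fin n} = Finₚ._≟_
_≟ᴱ_ {c ⊕ d} = Sumₚ.≡-dec _≟ᴱ_ _≟ᴱ_
_≟ᴱ_ {c ⊗ d} = ≡-dec _≟ᴱ_ _≟ᴱ_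

enumeration : ∀ c → Fin (size c) ↔ El c
enumeration (fin n) = ↔-id _
enumeration (c ⊕ d) = (enumeration c ⊎-↔ enumeration d) ↔-∘ Finₚ.+↔⊎
enumeration (c ⊗ d) = (enumeration c ×-↔ enumeration d) ↔-∘ Finₚ.*↔×

∑ : ∀ c → (El c → ℕ) → ℕ
∑ (fin n) f = Σₙ.sum f
∑ (c ⊕ d) f = ∑ c (f ∘ inj₁) + ∑ d (f ∘ inj₂)
∑ (c ⊗ d) f = ∑ c λ i → ∑ d λ j → f (i , j)

∑-cong : ∀ c {f g : El c → ℕ} → f ≗ g → ∑ c f ≡ ∑ c g
∑-cong (fin n) f≗g = Σₙ.sum-cong-≗ f≗g
∑-cong (c ⊕ d) f≗g = cong₂ _+_ (∑-cong c (f≗g ∘ inj₁)) (∑-cong d (f≗g ∘ inj₂))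
∑-cong (c ⊗ d) f≗g = ∑-cong c λ i → ∑-cong d λ j → f≗g (i , j)

∑-+ : ∀ c (f g : El c → ℕ) → ∑ c (λ i → f i + g i) ≡ ∑ c f + ∑ c g
∑-+ (fin n) f g = Σₙ.∑-distrib-+ f g
∑-+ (c ⊕ d) f g =
  trans (cong₂ _+_ (∑-+ c (f ∘ inj₁) (g ∘ inj₁)) (∑-+ d (f ∘ inj₂) (g ∘ inj₂)))
        (interchange (∑ c (f ∘ inj₁)) _ _ _)
∑-+ (c ⊗ d) f g =
  trans (∑-cong c λ i → ∑-+ d (λ j → f (i , j)) (λ j → g (i , j))) (∑-+ c _ _)

∑-*ˡ : ∀ c k (f : El c → ℕ) → ∑ c (λ i → k * f i) ≡ k * ∑ c f
∑-*ˡ (fin n) k f = sym (Σₙ.*-distribˡ-sum k f)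
∑-*ˡ (c ⊕ d) k f =
  trans (cong₂ _+_ (∑-*ˡ c k (f ∘ inj₁)) (∑-*ˡ d k (f ∘ inj₂))) (sym (*-distribˡ-+ k (∑ c (f ∘ inj₁)) _))
∑-*ˡ (c ⊗ d) k f =
  trans (∑-cong c λ i → ∑-*ˡ d k (λ j → f (i , j))) (∑-*ˡ c k _)

∑-*ʳ : ∀ c k (f : El c → ℕ) → ∑ c (λ i → f i * k) ≡ ∑ c f * k
∑-*ʳ c k f = trans (∑-cong c λ i → *-comm (f i) k) (trans (∑-*ˡ c k f) (*-comm k _))

∑-× : ∀ c d (f : El c → ℕ) (g : El d → ℕ) → ∑ (c ⊗ d) (λ (i , j) → f i * g j) ≡ ∑ c f * ∑ d g
∑-× c d f g = trans (∑-cong c λ i → ∑-*ˡ d (f i) g) (∑-*ʳ c (∑ d g) f)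

∑-0 : ∀ c → ∑ c (λ _ → 0) ≡ 0
∑-0 c = ∑-*ˡ c 0 (λ _ → 0)

∑-1 : ∀ c → ∑ c (λ _ → 1) ≡ size c
∑-1 (fin zero)    = refl
∑-1 (fin (suc n)) = cong suc (∑-1 (fin n))
∑-1 (c ⊕ d)       = cong₂ _+_ (∑-1 c) (∑-1 d)
∑-1 (c ⊗ d)       = begin
  ∑ c (λ _ → ∑ d (λ _ → 1)) ≡⟨ ∑-cong c (λ _ → trans (∑-1 d) (sym (*-identityˡ _))) ⟩
  ∑ c (λ _ → 1 * size d)    ≡⟨ ∑-*ʳ c (size d) (λ _ → 1) ⟩
  ∑ c (λ _ → 1) * size d    ≡⟨ cong (_* size d) (∑-1 c) ⟩
  size c * size d           ∎

∑-const : ∀ c k → ∑ c (λ _ → k) ≡ size c * k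
∑-const c k = begin
  ∑ c (λ _ → k)     ≡⟨ ∑-cong c (λ _ → sym (*-identityˡ k)) ⟩
  ∑ c (λ _ → 1 * k) ≡⟨ ∑-*ʳ c k (λ _ → 1) ⟩
  ∑ c (λ _ → 1) * k ≡⟨ cong (_* k) (∑-1 c) ⟩
  size c * k        ∎

∑-swap : ∀ c d (f : El c → El d → ℕ) →
         ∑ c (λ i → ∑ d (f i)) ≡ ∑ d (λ j → ∑ c (λ i → f i j))
∑-swap (fin zero)    d f = sym (∑-0 d)
∑-swap (fin (suc n)) d f =
  trans (cong (∑ d (f zero) +_) (∑-swap (fin n) d (f ∘ suc))) (sym (∑-+ d (f zero) _))
∑-swap (c₁ ⊕ c₂) d f =
  trans (cong₂ _+_ (∑-swap c₁ d (f ∘ inj₁)) (∑-swap c₂ d (f ∘ inj₂))) (sym (∑-+ d _ _))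
∑-swap (c₁ ⊗ c₂) d f =
  trans (∑-cong c₁ λ i → ∑-swap c₂ d (λ j → f (i , j))) (∑-swap c₁ d _)

∑-zero : ∀ c {f : El c → ℕ} → (∀ i → f i ≡ 0) → ∑ c f ≡ 0
∑-zero c f≗0 = trans (∑-cong c f≗0) (∑-0 c)

∑-single : ∀ c {f : El c → ℕ} i → (∀ j → j ≢ i → f j ≡ 0) → ∑ c f ≡ f i
∑-single (fin (suc n)) {f} zero    f≡0 =
  trans (cong (f zero +_) (∑-zero (fin n) λ j → f≡0 (suc j) λ ())) (+-identityʳ _)
∑-single (fin (suc n)) (suc i) f≡0 =
  cong₂ _+_ (f≡0 zero λ ()) (∑-single (fin n) i λ j j≢i → f≡0 (suc j) (j≢i ∘ Finₚ.suc-injective))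
∑-single (c ⊕ d) (inj₁ i) f≡0 =
  trans (cong₂ _+_ (∑-single c i λ j j≢i → f≡0 (inj₁ j) (j≢i ∘ Sumₚ.inj₁-injective))
                   (∑-zero d λ j → f≡0 (inj₂ j) λ ()))
        (+-identityʳ _)
∑-single (c ⊕ d) (inj₂ i) f≡0 =
  cong₂ _+_ (∑-zero c λ j → f≡0 (inj₁ j) λ ())
            (∑-single d i λ j j≢i → f≡0 (inj₂ j) (j≢i ∘ Sumₚ.inj₂-injective))
∑-single (c ⊗ d) (i , j) f≡0 =
  trans (∑-single c i λ i′ i′≢i → ∑-zero d λ j′ → f≡0 (i′ , j′) (i′≢i ∘ cong proj₁))
        (∑-single d j λ j′ j′≢j → f≡0 (i , j′) (j′≢j ∘ cong proj₂))

∑≡0⇒≡0 : ∀ c {f : El c → ℕ} → ∑ c f ≡ 0 → ∀ i → f i ≡ 0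
∑≡0⇒≡0 (fin (suc n)) {f} eq zero    = m+n≡0⇒m≡0 (f zero) eq
∑≡0⇒≡0 (fin (suc n)) {f} eq (suc i) = ∑≡0⇒≡0 (fin n) (m+n≡0⇒n≡0 (f zero) eq) i
∑≡0⇒≡0 (c ⊕ d) {f} eq (inj₁ i) = ∑≡0⇒≡0 c (m+n≡0⇒m≡0 (∑ c (f ∘ inj₁)) eq) i
∑≡0⇒≡0 (c ⊕ d) {f} eq (inj₂ j) = ∑≡0⇒≡0 d (m+n≡0⇒n≡0 (∑ c (f ∘ inj₁)) eq) j
∑≡0⇒≡0 (c ⊗ d) eq (i , j) = ∑≡0⇒≡0 d (∑≡0⇒≡0 c eq i) j

𝟙 : Dec P → ℕ
𝟙 P? = if does P? then 1 else 0

𝟙-yes : (P? : Dec P) → P → 𝟙 P? ≡ 1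
𝟙-yes P? p = cong (if_then 1 else 0) (dec-true P? p)

𝟙-no : (P? : Dec P) → ¬ P → 𝟙 P? ≡ 0
𝟙-no P? ¬p = cong (if_then 1 else 0) (dec-false P? ¬p)

𝟙-⇔ : P ⇔ Q → (P? : Dec P) (Q? : Dec Q) → 𝟙 P? ≡ 𝟙 Q?
𝟙-⇔ P⇔Q P? Q? = cong (if_then 1 else 0) (does-⇔ P⇔Q P? Q?)

𝟙-× : (P? : Dec P) (Q? : Dec Q) → 𝟙 (P? ×-dec Q?) ≡ 𝟙 P? * 𝟙 Q?
𝟙-× (yes _) Q? = sym (+-identityʳ _)
𝟙-× (no _)  Q? = refl

∑-𝟙 : ∀ c {R : Pred (El c) a} (R? : Decidable R) (f : El c → ℕ) {i} →
      R i → (∀ {j} → R j → j ≡ i) → ∑ c (λ j → 𝟙 (R? j) * f j) ≡ f i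
∑-𝟙 c R? f {i} Ri unique =
  trans (∑-single c i λ j j≢i → cong (_* f j) (𝟙-no (R? j) (j≢i ∘ unique)))
        (trans (cong (_* f i) (𝟙-yes (R? i) Ri)) (+-identityʳ _))

∑-𝟙₁ : ∀ c {R : Pred (El c) a} (R? : Decidable R) {i} →
       R i → (∀ {j} → R j → j ≡ i) → ∑ c (𝟙 ∘ R?) ≡ 1
∑-𝟙₁ c R? Ri unique =
  trans (∑-cong c λ j → sym (*-identityʳ _)) (∑-𝟙 c R? (λ _ → 1) Ri unique)

-- The two codes may have different shapes, so no common recursion is available. Instead each `f j`
-- is spread over the one `i` with `φ.to i ≡ j`, and the order of summation is exchanged.
∑-reindex : ∀ c d (φ : El c ↔ El d) (f : El d → ℕ) → ∑ d f ≡ ∑ c (f ∘ Inverse.to φ)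
∑-reindex c d φ f = begin
  ∑ d f
    ≡⟨ ∑-cong d (λ j → sym (∑-𝟙 c (λ i → φ.to i ≟ᴱ j) (λ _ → f j) (φ.strictlyInverseˡ j)
                                    (λ φi≡j → sym (φ.inverseʳ (sym φi≡j))))) ⟩
  ∑ d (λ j → ∑ c λ i → 𝟙 (φ.to i ≟ᴱ j) * f j)
    ≡⟨ ∑-swap d c _ ⟩
  ∑ c (λ i → ∑ d λ j → 𝟙 (φ.to i ≟ᴱ j) * f j)
    ≡⟨ ∑-cong c (λ i → ∑-𝟙 d (λ j → φ.to i ≟ᴱ j) f refl sym) ⟩
  ∑ c (f ∘ φ.to) ∎
  where module φ = Inverse φ

-- Each `j` is incident with at most one `i`, namely `at j`, and only if `L j`; exchanging the sums
-- leaves one weight per such `j`. In `double-count`, `j` is a block with two positions in its list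
-- of points, and `at j` is the pair of points found there.
∑-incidences : ∀ c d (w : El c → ℕ) {b} {I : El c → El d → Set a} (I? : ∀ i j → Dec (I i j))
               {L : Pred (El d) b} (L? : Decidable L) (at : El d → El c) →
               (∀ {j} → L j → I (at j) j) → (∀ {i j} → I i j → L j × i ≡ at j) →
               ∑ c (λ i → w i * ∑ d (𝟙 ∘ I? i)) ≡ ∑ d (λ j → 𝟙 (L? j) * w (at j))
∑-incidences c d w I? L? at to from = begin
  ∑ c (λ i → w i * ∑ d (𝟙 ∘ I? i))       ≡⟨ ∑-cong c (λ i → ∑-*ˡ d (w i) (𝟙 ∘ I? i)) ⟨
  ∑ c (λ i → ∑ d λ j → w i * 𝟙 (I? i j)) ≡⟨ ∑-swap c d (λ i j → w i * 𝟙 (I? i j)) ⟩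
  ∑ d (λ j → ∑ c λ i → w i * 𝟙 (I? i j)) ≡⟨ ∑-cong d at-j ⟩
  ∑ d (λ j → 𝟙 (L? j) * w (at j))        ∎
  where
  at-j : ∀ j → ∑ c (λ i → w i * 𝟙 (I? i j)) ≡ 𝟙 (L? j) * w (at j)
  at-j j = begin
    ∑ c (λ i → w i * 𝟙 (I? i j))  ≡⟨ ∑-single c (at j) (λ i i≢ → trans
                                       (cong (w i *_) (𝟙-no (I? i j) (i≢ ∘ proj₂ ∘ from))) (*-zeroʳ (w i))) ⟩
    w (at j) * 𝟙 (I? (at j) j)    ≡⟨ cong (w (at j) *_) (𝟙-⇔ (mk⇔ (proj₁ ∘ from) to) (I? (at j) j) (L? j)) ⟩
    w (at j) * 𝟙 (L? j)           ≡⟨ *-comm (w (at j)) _ ⟩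
    𝟙 (L? j) * w (at j)           ∎

-- Cardinalities of setoids and of decidable subsets

module _ {a₁ a₂ ℓ₁ ℓ₂} {S : Setoid a₁ ℓ₁} {T : Setoid a₂ ℓ₂} where
  private
    module S = Setoid S
    module T = Setoid T

  mkInverse : (f : S.Carrier → T.Carrier) → Congruent S._≈_ T._≈_ f →
              Injective S._≈_ T._≈_ f → StrictlySurjective T._≈_ f → Inverse S T
  mkInverse f f-cong f-inj f-surj = Bijection⇒Inverse record
    { to = f ; cong = f-cong
    ; bijective = f-inj , strictlySurjective⇒surjective T.trans f-cong f-surj }

  to-injective : (φ : Inverse S T) → Injective S._≈_ T._≈_ (Inverse.to φ)
  to-injective φ = Injection.injective (Inverse⇒Injection φ)

infixr 9 _⨾_
_⨾_ : ∀ {a₁ a₂ a₃ ℓ₁ ℓ₂ ℓ₃} {S : Setoid a₁ ℓ₁} {T : Setoid a₂ ℓ₂} {U : Setoid a₃ ℓ₃} →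
      Inverse S T → Inverse T U → Inverse S U
_⨾_ = Composition.inverse

HasCardinality-unique : {S : Setoid a ℓ} {m n : ℕ} → HasCardinality S m → HasCardinality S n → m ≡ n
HasCardinality-unique φ ψ = ↔⇒≡ (φ ⨾ Symmetry.inverse ψ)

restrict : {A B : Set} (φ : A ↔ B) (R : Pred B a) →
           Inverse (subsetoid (setoid A) (R ∘ Inverse.to φ)) (subsetoid (setoid B) R)
restrict φ R = mkInverse
  (λ (x , r) → φ.to x , r) (cong φ.to) (to-injective φ)
  (λ (y , r) → (φ.from y , subst R (sym (φ.strictlyInverseˡ y)) r) , φ.strictlyInverseˡ y)
  where module φ = Inverse φ

Fin-subset-card : ∀ n {R : Pred (Fin n) a} (R? : Decidable R) →
                  HasCardinality (subsetoid (setoid (Fin n)) R) (∑ (fin n) (𝟙 ∘ R?))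
Fin-subset-card zero R? = mkInverse (λ ()) (λ { {()} }) (λ { {()} }) (λ { (() , _) })
Fin-subset-card (suc n) {R} R? with R? zero | Fin-subset-card n (R? ∘ suc)
... | yes r₀ | φ = mkInverse f (cong (proj₁ ∘ f)) f-inj f-surj
  where
  module φ = Inverse φ
  f : Fin _ → Σ (Fin (suc n)) R
  f zero    = zero , r₀
  f (suc i) = let j , r = φ.to i in suc j , r
  f-inj : ∀ {i j} → proj₁ (f i) ≡ proj₁ (f j) → i ≡ j
  f-inj {zero}  {zero}  _  = refl
  f-inj {zero}  {suc _} ()
  f-inj {suc _} {zero}  ()
  f-inj {suc i} {suc j} eq = cong suc (to-injective φ (Finₚ.suc-injective eq))
  f-surj : ∀ y → ∃ λ i → proj₁ (f i) ≡ proj₁ y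
  f-surj (zero , _)  = zero , refl
  f-surj (suc j , r) = suc (φ.from (j , r)) , cong suc (φ.strictlyInverseˡ (j , r))
... | no ¬r₀ | φ = mkInverse f (cong (proj₁ ∘ f)) (to-injective φ ∘ Finₚ.suc-injective) f-surj
  where
  module φ = Inverse φ
  f : Fin _ → Σ (Fin (suc n)) R
  f i = let j , r = φ.to i in suc j , r
  f-surj : ∀ y → ∃ λ i → proj₁ (f i) ≡ proj₁ y
  f-surj (zero , r)  = contradiction r ¬r₀
  f-surj (suc j , r) = φ.from (j , r) , cong suc (φ.strictlyInverseˡ (j , r))

subset-card : ∀ c {R : Pred (El c) a} (R? : Decidable R) →
              HasCardinality (subsetoid (setoid (El c)) R) (∑ c (𝟙 ∘ R?))
subset-card c {R} R? = subst (HasCardinality _) (sym (∑-reindex (fin (size c)) c φ (𝟙 ∘ R?)))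
  (Fin-subset-card (size c) (R? ∘ Inverse.to φ) ⨾ restrict φ R)
  where φ = enumeration c

-- Permutations and images

MutuallyInverse : ∀ {e} → (f g : Fin e → Fin e) → Set
MutuallyInverse f g = (∀ x → f (g x) ≡ x) × (∀ x → g (f x) ≡ x)

mutuallyInverse? : ∀ {e} (f g : Fin e → Fin e) → Dec (MutuallyInverse f g)
mutuallyInverse? f g = Finₚ.all? (λ x → f (g x) Finₚ.≟ x) ×-dec Finₚ.all? (λ x → g (f x) Finₚ.≟ x)

permutationFrom : ∀ {e} (f g : Fin e → Fin e) → Dec (MutuallyInverse f g) → Fin e ↔ Fin e
permutationFrom f g (yes (fg≗id , gf≗id)) = mk↔ₛ′ f g fg≗id gf≗id
permutationFrom f g (no _)                = ↔-id _

permutationFrom-to : ∀ {e} (f g : Fin e → Fin e) (inv? : Dec (MutuallyInverse f g)) →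
                     MutuallyInverse f g → Inverse.to (permutationFrom f g inv?) ≗ f
permutationFrom-to f g (yes _)   _   x = refl
permutationFrom-to f g (no ¬inv) inv x = contradiction inv ¬inv

-- The pairs of functions that are not mutually inverse stand for the identity.
permutation : ∀ e → El (fin (e ^ e) ⊗ fin (e ^ e)) → Fin e ↔ Fin e
permutation e (i , j) = permutationFrom (finToFun i) (finToFun j) (mutuallyInverse? (finToFun i) (finToFun j))

permutation-surjective : ∀ e (σ : Fin e ↔ Fin e) →
                         ∃ λ i → Inverse.to (permutation e i) ≗ Inverse.to σ
permutation-surjective e σ = (funToFin σ.to , funToFin σ.from) , λ x →
  trans (permutationFrom-to f g (mutuallyInverse? f g)
          ( (λ x → trans (f≗to _) (trans (cong σ.to (g≗from x)) (σ.strictlyInverseˡ x)))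
          , (λ x → trans (g≗from _) (trans (cong σ.from (f≗to x)) (σ.strictlyInverseʳ x)))) x)
        (f≗to x)
  where
  module σ = Inverse σ
  f      = finToFun (funToFin σ.to)
  g      = finToFun (funToFin σ.from)
  f≗to   = Finₚ.finToFun-funToFin σ.to
  g≗from = Finₚ.finToFun-funToFin σ.from

transpose-matchˡ : ∀ {e} (i j : Fin e) → PC.transpose i j i ≡ j
transpose-matchˡ i j rewrite dec-true (i Finₚ.≟ i) refl = refl

transpose-mismatch : ∀ {e} {i j k : Fin e} → k ≢ i → k ≢ j → PC.transpose i j k ≡ k
transpose-mismatch {i = i} {j} {k} k≢i k≢j
  rewrite dec-false (k Finₚ.≟ i) k≢i | dec-false (k Finₚ.≟ j) k≢j = refl

-- First `x` is exchanged with `x′`, then the image `y₁` of `y` with `y′`. The second transposition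
-- does not disturb `x′`: either `y₁` and `y′` both equal `x′`, or neither does.
two-transitive : ∀ {e} (x y x′ y′ : Fin e) → does (x Finₚ.≟ y) ≡ does (x′ Finₚ.≟ y′) →
                 ∃ λ (σ : Fin e ↔ Fin e) → Inverse.to σ x ≡ x′ × Inverse.to σ y ≡ y′
two-transitive {e} x y x′ y′ same =
  transpose y₁ y′ ↔-∘ transpose x x′ ,
  trans (cong (PC.transpose y₁ y′) (transpose-matchˡ x x′)) (fixes (x Finₚ.≟ y) (x′ Finₚ.≟ y′) same) ,
  transpose-matchˡ y₁ y′
  where
  y₁ = PC.transpose x x′ y
  fixes : (x≟y : Dec (x ≡ y)) (x′≟y′ : Dec (x′ ≡ y′)) → does x≟y ≡ does x′≟y′ →
          PC.transpose y₁ y′ x′ ≡ x′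
  fixes (yes refl) (yes refl) _ =
    trans (cong (λ z → PC.transpose z x′ x′) (transpose-matchˡ x x′)) (transpose-matchˡ x′ x′)
  fixes (no x≢y) (no x′≢y′) _ = transpose-mismatch
    (λ x′≡y₁ → x≢y (to-injective (transpose x x′) (trans (transpose-matchˡ x x′) x′≡y₁))) x′≢y′

χ : ∀ {e} → Bool → Fin e → Fin e → ℕ
χ b x x′ = 𝟙 (does (x Finₚ.≟ x′) Boolₚ.≟ b)

factor : Bool → ℕ → ℕ
factor true  e = 1
factor false e = e ∸ 1

χ-split : ∀ {e} (x x′ : Fin e) → χ true x x′ + χ false x x′ ≡ 1
χ-split x x′ with does (x Finₚ.≟ x′)
... | true  = refl
... | false = refl

χ-true : ∀ {e} (x x′ : Fin e) → χ true x x′ ≡ 𝟙 (x Finₚ.≟ x′)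
χ-true x x′ with does (x Finₚ.≟ x′)
... | true  = refl
... | false = refl

χ-invariant : ∀ {e} b (σ : Fin e ↔ Fin e) x x′ → χ b (Inverse.to σ x) (Inverse.to σ x′) ≡ χ b x x′
χ-invariant b σ x x′ =
  cong (λ d → 𝟙 (d Boolₚ.≟ b)) (does-⇔ (mk⇔ (to-injective σ) (cong (Inverse.to σ)))
    (Inverse.to σ x Finₚ.≟ Inverse.to σ x′) (x Finₚ.≟ x′))

∑-χ : ∀ {e} b (x : Fin e) → ∑ (fin e) (χ b x) ≡ factor b e
∑-χ {e} true x = trans (∑-cong (fin e) (χ-true x)) (∑-𝟙₁ (fin e) (x Finₚ.≟_) refl sym)
∑-χ {e} false x = begin
  ∑ (fin e) (χ false x)                              ≡⟨ m+n∸m≡n 1 _ ⟨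
  1 + ∑ (fin e) (χ false x) ∸ 1                      ≡⟨ cong (λ k → k + ∑ (fin e) (χ false x) ∸ 1) (∑-χ true x) ⟨
  ∑ (fin e) (χ true x) + ∑ (fin e) (χ false x) ∸ 1   ≡⟨ cong (_∸ 1) (∑-+ (fin e) (χ true x) (χ false x)) ⟨
  ∑ (fin e) (λ x′ → χ true x x′ + χ false x x′) ∸ 1  ≡⟨ cong (_∸ 1) (∑-cong (fin e) (χ-split x)) ⟩
  ∑ (fin e) (λ _ → 1) ∸ 1                            ≡⟨ cong (_∸ 1) (∑-1 (fin e)) ⟩
  e ∸ 1                                              ∎

image-cong : {Ω : Set} {g h : Ω ↔ Ω} (X : Pred Ω 0ℓ) → Inverse.to g ≗ Inverse.to h → image g X ≐ image h X
image-cong X g≗h =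
  (λ (x , x∈X , gx≡y) → x , x∈X , trans (sym (g≗h x)) gx≡y) ,
  (λ (x , x∈X , hx≡y) → x , x∈X , trans (g≗h x) hx≡y)

image-mono : {Ω : Set} (g : Ω ↔ Ω) {X Y : Pred Ω 0ℓ} → X ⊆ Y → image g X ⊆ image g Y
image-mono g X⊆Y (x , x∈X , eq) = x , X⊆Y x∈X , eq

image-≐ : {Ω : Set} (g : Ω ↔ Ω) {X Y : Pred Ω 0ℓ} → X ≐ Y → image g X ≐ image g Y
image-≐ g (X⊆Y , Y⊆X) = image-mono g X⊆Y , image-mono g Y⊆X

image-∘ : {Ω : Set} (g h : Ω ↔ Ω) (X : Pred Ω 0ℓ) → image g (image h X) ≐ image (g ↔-∘ h) X
image-∘ g h X =
  (λ { (_ , (x , x∈X , refl) , eq) → x , x∈X , eq }) ,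
  (λ (x , x∈X , eq) → Inverse.to h x , (x , x∈X , refl) , eq)

image-id : {Ω : Set} (g : Ω ↔ Ω) (X : Pred Ω 0ℓ) → (∀ x → Inverse.to g x ≡ x) → image g X ≐ X
image-id g X g≗id =
  (λ { (x , x∈X , refl) → subst X (sym (g≗id x)) x∈X }) ,
  (λ {x} x∈X → x , x∈X , g≗id x)

image-inverseˡ : {Ω : Set} (g : Ω ↔ Ω) (X : Pred Ω 0ℓ) → image g (image (↔-sym g) X) ≐ X
image-inverseˡ g X =
  ≐-trans (image-∘ g (↔-sym g) X) (image-id (g ↔-∘ ↔-sym g) X (Inverse.strictlyInverseˡ g))

image-inverseʳ : {Ω : Set} (g : Ω ↔ Ω) (X : Pred Ω 0ℓ) → image (↔-sym g) (image g X) ≐ X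
image-inverseʳ g X =
  ≐-trans (image-∘ (↔-sym g) g X) (image-id (↔-sym g ↔-∘ g) X (Inverse.strictlyInverseʳ g))

module _ {Ω : Set} (B : Pred Ω 0ℓ) (G : PermutationGroup Ω) where
  open IncidenceStructure (𝒟 B G)

  image∈Block : ∀ {g X} → g ∈ Member G → X ∈ Block → image g X ∈ Block
  image∈Block {g} {X} g∈G (h , h∈G , X≐hB) =
    g ↔-∘ h , PermutationGroup.∘-mem G g∈G h∈G , ≐-trans (image-≐ g X≐hB) (image-∘ g h B)

  𝒟-automorphisms : IsAutomorphismGroup (𝒟 B G) G
  𝒟-automorphisms g g∈G X = mk⇔ (image∈Block g∈G) λ gX∈Block →
    resp-≐ (image-inverseʳ g X) (image∈Block (PermutationGroup.sym-mem G g∈G) gX∈Block)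

  𝒟-blockTransitive : BlockTransitive (𝒟 B G) G
  𝒟-blockTransitive X Y (g , g∈G , X≐gB) (h , h∈G , Y≐hB) =
    h ↔-∘ ↔-sym g , PermutationGroup.∘-mem G h∈G (PermutationGroup.sym-mem G g∈G) ,
    ≐-trans (≐-sym (image-∘ h (↔-sym g) X))
      (≐-trans (image-≐ h (≐-trans (image-≐ (↔-sym g) X≐gB) (image-inverseʳ g B))) (≐-sym Y≐hB))

  blocksThrough-image : ∀ {g} → g ∈ Member G → ∀ x y →
    Inverse (blocksThrough x y) (blocksThrough (Inverse.to g x) (Inverse.to g y))
  blocksThrough-image {g} g∈G x y = mkInverse
    (λ (X , X∈Block , x∈X , y∈X) →
      image g X , image∈Block g∈G X∈Block , (x , x∈X , refl) , (y , y∈X , refl))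
    (image-≐ g)
    (λ {(X , _)} {(Y , _)} gX≐gY → ≐-trans (≐-sym (image-inverseʳ g X))
      (≐-trans (image-≐ (↔-sym g) gX≐gY) (image-inverseʳ g Y)))
    (λ (Y , Y∈Block , gx∈Y , gy∈Y) →
      ( image (↔-sym g) Y , image∈Block (PermutationGroup.sym-mem G g∈G) Y∈Block
      , (_ , gx∈Y , Inverse.strictlyInverseʳ g x) , (_ , gy∈Y , Inverse.strictlyInverseʳ g y)) ,
      image-inverseˡ g Y)

Sym³-gridImprimitive : ∀ {a b c} → 1 < a → 1 < b → 1 < c → GridImprimitive₃ (Sym³ (Fin a) (Fin b) (Fin c))
Sym³-gridImprimitive {a} {b} {c} 1<a 1<b 1<c =
  Fin a , Fin b , Fin c , distinct 1<a , distinct 1<b , distinct 1<c , ↔-id _ , λ g g∈G → g∈G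
  where
  distinct : ∀ {n} → 1 < n → ∃₂ λ (x y : Fin n) → x ≢ y
  distinct (s≤s (s≤s z≤n)) = zero , suc zero , λ ()

-- Designs from transitive groups on a grid

record Enumerates {Ω : Set} {k : ℕ} (pt : Fin k → Ω) (B : Pred Ω 0ℓ) : Set where
  field
    injective : ∀ {i j} → pt i ≡ pt j → i ≡ j
    sound     : ∀ i → pt i ∈ B
    complete  : ∀ {s} → s ∈ B → ∃ λ i → pt i ≡ s

module PointGrid (E₁ E₂ E₃ : ℕ) where

  points : Code
  points = fin E₁ ⊗ fin E₂ ⊗ fin E₃

  _≟ₚ_ : DecidableEquality (El points)
  _≟ₚ_ = _≟ᴱ_ {points}

  group : PermutationGroup (El points)
  group = Sym³ (Fin E₁) (Fin E₂) (Fin E₃)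

  Agreement : Set
  Agreement = Bool × Bool × Bool

  agreement : El points → El points → Agreement
  agreement (x , y , z) (x′ , y′ , z′) = does (x Finₚ.≟ x′) , does (y Finₚ.≟ y′) , does (z Finₚ.≟ z′)

  -- The indicator of `agreement s t ≡ J`, in product form so that its sum over the grid factors by
  -- coordinates.
  τ : Agreement → El points → El points → ℕ
  τ (b₁ , b₂ , b₃) (x , y , z) (x′ , y′ , z′) = χ b₁ x x′ * (χ b₂ y y′ * χ b₃ z z′)

  neighbours : Agreement → ℕ
  neighbours (b₁ , b₂ , b₃) = factor b₁ E₁ * (factor b₂ E₂ * factor b₃ E₃)

  ∑-τ : ∀ J s → ∑ points (τ J s) ≡ neighbours J
  ∑-τ (b₁ , b₂ , b₃) (x , y , z) = begin
    ∑ points (τ (b₁ , b₂ , b₃) (x , y , z))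
      ≡⟨ ∑-× (fin E₁) (fin E₂ ⊗ fin E₃) (χ b₁ x) (λ (y′ , z′) → χ b₂ y y′ * χ b₃ z z′) ⟩
    ∑ (fin E₁) (χ b₁ x) * ∑ (fin E₂ ⊗ fin E₃) (λ (y′ , z′) → χ b₂ y y′ * χ b₃ z z′)
      ≡⟨ cong (∑ (fin E₁) (χ b₁ x) *_) (∑-× (fin E₂) (fin E₃) (χ b₂ y) (χ b₃ z)) ⟩
    ∑ (fin E₁) (χ b₁ x) * (∑ (fin E₂) (χ b₂ y) * ∑ (fin E₃) (χ b₃ z))
      ≡⟨ cong₂ _*_ (∑-χ b₁ x) (cong₂ _*_ (∑-χ b₂ y) (∑-χ b₃ z)) ⟩
    neighbours (b₁ , b₂ , b₃) ∎

  τ-agreement : ∀ s t → τ (agreement s t) s t ≡ 1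
  τ-agreement (x , y , z) (x′ , y′ , z′)
    rewrite 𝟙-yes (does (x Finₚ.≟ x′) Boolₚ.≟ _) refl
          | 𝟙-yes (does (y Finₚ.≟ y′) Boolₚ.≟ _) refl
          | 𝟙-yes (does (z Finₚ.≟ z′) Boolₚ.≟ _) refl = refl

  τ-nonzero : ∀ J s t → τ J s t ≡ 0 ⊎ agreement s t ≡ J
  τ-nonzero (b₁ , b₂ , b₃) (x , y , z) (x′ , y′ , z′)
    with does (x Finₚ.≟ x′) Boolₚ.≟ b₁ | does (y Finₚ.≟ y′) Boolₚ.≟ b₂ | does (z Finₚ.≟ z′) Boolₚ.≟ b₃
  ... | no _     | _        | _        = inj₁ refl
  ... | yes _    | no _     | _        = inj₁ refl
  ... | yes _    | yes _    | no _     = inj₁ refl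
  ... | yes refl | yes refl | yes refl = inj₂ refl

  τ-invariant : ∀ J {g} → g ∈ Member group → ∀ s t →
                τ J (Inverse.to g s) (Inverse.to g t) ≡ τ J s t
  τ-invariant (b₁ , b₂ , b₃) {g} (σ₁ , σ₂ , σ₃ , g≗) s@(x , y , z) t@(x′ , y′ , z′)
    rewrite g≗ s | g≗ t | χ-invariant b₁ σ₁ x x′ | χ-invariant b₂ σ₂ y y′ | χ-invariant b₃ σ₃ z z′ = refl

  agreement-transitive : ∀ s t s′ t′ → agreement s t ≡ agreement s′ t′ →
    ∃ λ g → g ∈ Member group × Inverse.to g s ≡ s′ × Inverse.to g t ≡ t′
  agreement-transitive (x , y , z) (u , v , w) (x′ , y′ , z′) (u′ , v′ , w′) same =
    let σ₁ , x↦ , u↦ = two-transitive x u x′ u′ (cong proj₁ same)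
        σ₂ , y↦ , v↦ = two-transitive y v y′ v′ (cong (proj₁ ∘ proj₂) same)
        σ₃ , z↦ , w↦ = two-transitive z w z′ w′ (cong (proj₂ ∘ proj₂) same)
    in coordinatewise σ₁ σ₂ σ₃ , (σ₁ , σ₂ , σ₃ , λ _ → refl) ,
       cong₂ _,_ x↦ (cong₂ _,_ y↦ z↦) , cong₂ _,_ u↦ (cong₂ _,_ v↦ w↦)

  agreement-full : ∀ s t → agreement s t ≡ (true , true , true) → s ≡ t
  agreement-full (x , y , z) (x′ , y′ , z′) eq with x Finₚ.≟ x′ | y Finₚ.≟ y′ | z Finₚ.≟ z′
  ... | yes refl | yes refl | yes refl = refl
  agreement-full _ _ () | no _  | _     | _
  agreement-full _ _ () | yes _ | no _  | _
  agreement-full _ _ () | yes _ | yes _ | no _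

  -- Each coordinate contributes a pair of functions, read as a permutation and its inverse. The
  -- resulting list repeats group elements; it only has to reach all of them, since repeated blocks
  -- are removed by `Leader`.
  elements : Code
  elements = (fin (E₁ ^ E₁) ⊗ fin (E₁ ^ E₁)) ⊗ (fin (E₂ ^ E₂) ⊗ fin (E₂ ^ E₂)) ⊗ (fin (E₃ ^ E₃) ⊗ fin (E₃ ^ E₃))

  order : ℕ
  order = size elements

  elementAt : El elements → El points ↔ El points
  elementAt (i , j , k) = coordinatewise (permutation E₁ i) (permutation E₂ j) (permutation E₃ k)

  abstract
    element : Fin order → El points ↔ El points
    element h = elementAt (Inverse.to (enumeration elements) h)

    element∈group : ∀ h → element h ∈ Member group
    element∈group h =
      let i , j , k = Inverse.to (enumeration elements) h
      in permutation E₁ i , permutation E₂ j , permutation E₃ k , λ _ → refl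

    element-surjective : ∀ g → g ∈ Member group → ∃ λ h → Inverse.to (element h) ≗ Inverse.to g
    element-surjective g (σ₁ , σ₂ , σ₃ , g≗) =
      let i , i≗ = permutation-surjective E₁ σ₁
          j , j≗ = permutation-surjective E₂ σ₂
          k , k≗ = permutation-surjective E₃ σ₃
      in Inverse.from (enumeration elements) (i , j , k) , λ s@(x , y , z) →
         trans (cong (λ c → Inverse.to (elementAt c) s) (Inverse.strictlyInverseˡ (enumeration elements) (i , j , k)))
               (trans (cong₂ _,_ (i≗ x) (cong₂ _,_ (j≗ y) (k≗ z))) (sym (g≗ s)))

  module Orbit {k : ℕ} (pt : Fin k → El points) (B : Pred (El points) 0ℓ) (enum : Enumerates pt B) where
    open Enumerates enum
    open IncidenceStructure (𝒟 B group)

    block : Fin order → Pred (El points) 0ℓ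
    block h = image (element h) B

    ptOf : Fin order → Fin k → El points
    ptOf h i = Inverse.to (element h) (pt i)

    ptOf∈block : ∀ h i → ptOf h i ∈ block h
    ptOf∈block h i = pt i , sound i , refl

    ptOf-complete : ∀ h {s} → s ∈ block h → ∃ λ i → ptOf h i ≡ s
    ptOf-complete h (_ , x∈B , refl) with i , refl ← complete x∈B = i , refl

    ptOf-injective : ∀ h {i j} → ptOf h i ≡ ptOf h j → i ≡ j
    ptOf-injective h = injective ∘ to-injective (element h)

    block-⊆ : ∀ h h′ → (∀ i → ∃ λ j → ptOf h′ j ≡ ptOf h i) → block h ⊆ block h′
    block-⊆ h h′ covers s∈h =
      let i , i≡s = ptOf-complete h s∈h
          j , j≡i = covers i
      in subst (block h′) (trans j≡i i≡s) (ptOf∈block h′ j)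

    -- Blocks are predicates, but each is listed by finitely many points with decidable equality, so
    -- inclusion is a finite check.
    block-⊆? : ∀ h h′ → Dec (block h ⊆ block h′)
    block-⊆? h h′ = map′ (block-⊆ h h′) (λ h⊆h′ i → ptOf-complete h′ (h⊆h′ (ptOf∈block h i)))
      (Finₚ.all? λ i → Finₚ.any? λ j → ptOf h′ j ≟ₚ ptOf h i)

    block-≐? : ∀ h h′ → Dec (block h ≐ block h′)
    block-≐? h h′ = block-⊆? h h′ ×-dec block-⊆? h′ h

    -- Every block has exactly one leader, so summing over leaders is summing over blocks.
    Leader : Pred (Fin order) 0ℓ
    Leader h = ∀ h′ → h′ Fin.< h → ¬ (block h′ ≐ block h)

    abstract
      leader? : Decidable Leader
      leader? h = Finₚ.all? λ h′ → (h′ Finₚ.<? h) →-dec ¬? (block-≐? h′ h)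

    leader-unique : ∀ {h h′} → Leader h → Leader h′ → block h ≐ block h′ → h ≡ h′
    leader-unique {h} {h′} ℓ ℓ′ eq with Finₚ.<-cmp h h′
    ... | tri< h<h′ _ _ = contradiction eq (ℓ′ h h<h′)
    ... | tri≈ _ h≡h′ _ = h≡h′
    ... | tri> _ _ h′<h = contradiction (≐-sym eq) (ℓ h′ h′<h)

    leader-exists : ∀ h → ∃ λ h′ → Leader h′ × block h′ ≐ block h
    leader-exists h = go h (<-wellFounded h)
      where
      go : ∀ h → Acc Fin._<_ h → ∃ λ h′ → Leader h′ × block h′ ≐ block h
      go h (acc smaller) with Finₚ.any? (λ h′ → (h′ Finₚ.<? h) ×-dec block-≐? h′ h)
      ... | yes (h₁ , h₁<h , h₁≐h) = let h′ , ℓ , h′≐h₁ = go h₁ (smaller h₁<h) in h′ , ℓ , ≐-trans h′≐h₁ h₁≐h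
      ... | no none = h , (λ h′ h′<h h′≐h → none (h′ , h′<h , h′≐h)) , ≐-refl

    leaderOf : ∀ {X} → X ∈ Block → ∃ λ h → Leader h × block h ≐ X
    leaderOf (g , g∈G , X≐gB) =
      let h , h≗g = element-surjective g g∈G
          h′ , ℓ , h′≐h = leader-exists h
      in h′ , ℓ , ≐-trans h′≐h (≐-trans (image-cong {g = element h} {h = g} B h≗g) (≐-sym X≐gB))

    flags : Code
    flags = fin order ⊗ fin k ⊗ fin k

    -- A block through `s` and `t` has one leader, and each of the two points has one position in
    -- its list. Recording the positions therefore adds nothing to the count; it makes the blocks
    -- through a pair a decidable subset of a finite type and lets `double-count` sum over
    -- positions.
    Through : El points → El points → Pred (El flags) 0ℓ
    Through s t (h , i , j) = Leader h × ptOf h i ≡ s × ptOf h j ≡ t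

    through? : ∀ s t → Decidable (Through s t)
    through? s t (h , i , j) = leader? h ×-dec (ptOf h i ≟ₚ s) ×-dec (ptOf h j ≟ₚ t)

    flags↔blocksThrough : ∀ s t → Inverse (subsetoid (setoid (El flags)) (Through s t)) (blocksThrough s t)
    flags↔blocksThrough s t =
      mkInverse f (λ {u} {v} → f-cong {u} {v}) (λ {u} {v} → f-injective {u} {v}) f-surjective
      where
      f : Σ (El flags) (Through s t) → Setoid.Carrier (blocksThrough s t)
      f ((h , i , j) , _ , hi≡s , hj≡t) =
        block h , (element h , element∈group h , ≐-refl) , (pt i , sound i , hi≡s) , (pt j , sound j , hj≡t)

      f-cong : ∀ {u v} → proj₁ u ≡ proj₁ v → proj₁ (f u) ≐ proj₁ (f v)
      f-cong refl = ≐-refl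

      f-injective : ∀ {u v} → proj₁ (f u) ≐ proj₁ (f v) → proj₁ u ≡ proj₁ v
      f-injective {(h , i , j) , ℓ , hi≡s , hj≡t} {(h′ , i′ , j′) , ℓ′ , hi′≡s , hj′≡t} h≐h′
        with refl ← leader-unique ℓ ℓ′ h≐h′ =
        cong₂ (λ i j → h , i , j) (ptOf-injective h (trans hi≡s (sym hi′≡s)))
                                  (ptOf-injective h (trans hj≡t (sym hj′≡t)))

      f-surjective : ∀ (Y : Setoid.Carrier (blocksThrough s t)) → ∃ λ u → proj₁ (f u) ≐ proj₁ Y
      f-surjective (X , X∈Block , s∈X , t∈X) =
        let h , ℓ , h≐X = leaderOf X∈Block
            i , hi≡s    = ptOf-complete h (proj₂ h≐X s∈X)
            j , hj≡t    = ptOf-complete h (proj₂ h≐X t∈X)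
        in ((h , i , j) , ℓ , hi≡s , hj≡t) , h≐X

    replication : El points → El points → ℕ
    replication s t = ∑ flags (𝟙 ∘ through? s t)

    blocksThrough-card : ∀ s t → HasCardinality (blocksThrough s t) (replication s t)
    blocksThrough-card s t = subset-card flags (through? s t) ⨾ flags↔blocksThrough s t

    -- The group need not carry leaders to leaders, so the two sums are compared through the setoids
    -- of blocks whose cardinalities they are.
    replication-invariant : ∀ {g} → g ∈ Member group → ∀ s t →
      replication s t ≡ replication (Inverse.to g s) (Inverse.to g t)
    replication-invariant {g} g∈G s t =
      HasCardinality-unique (blocksThrough-card s t ⨾ blocksThrough-image B group {g} g∈G s t) (blocksThrough-card _ _)

    replication-agreement : ∀ s t s′ t′ → agreement s t ≡ agreement s′ t′ → replication s t ≡ replication s′ t′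
    replication-agreement s t s′ t′ same with g , g∈G , refl , refl ← agreement-transitive s t s′ t′ same =
      replication-invariant {g} g∈G s t

    blockCount : ℕ
    blockCount = ∑ (fin order) (𝟙 ∘ leader?)

    pairCount : Agreement → ℕ
    pairCount J = ∑ (fin k ⊗ fin k) λ (i , j) → τ J (pt i) (pt j)

    -- Both sides count the blocks together with an ordered pair of points of type J on them.
    double-count : ∀ J s₀ t₀ → agreement s₀ t₀ ≡ J →
      blockCount * pairCount J ≡ size points * neighbours J * replication s₀ t₀
    double-count J s₀ t₀ J≡ = begin
      blockCount * pairCount J
        ≡⟨ ∑-× (fin order) (fin k ⊗ fin k) (𝟙 ∘ leader?) (λ (i , j) → τ J (pt i) (pt j)) ⟨
      ∑ flags (λ (h , i , j) → 𝟙 (leader? h) * τ J (pt i) (pt j))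
        ≡⟨ ∑-cong flags (λ (h , i , j) → cong (𝟙 (leader? h) *_)
             (τ-invariant J {element h} (element∈group h) (pt i) (pt j))) ⟨
      ∑ flags (λ (h , i , j) → 𝟙 (leader? h) * τ J (ptOf h i) (ptOf h j))
        ≡⟨ ∑-incidences (points ⊗ points) flags (λ (s , t) → τ J s t)
             (λ (s , t) → through? s t) (λ (h , _) → leader? h) (λ (h , i , j) → ptOf h i , ptOf h j)
             (λ ℓ → ℓ , refl , refl) (λ { (ℓ , refl , refl) → ℓ , refl }) ⟨
      ∑ (points ⊗ points) (λ (s , t) → τ J s t * replication s t)
        ≡⟨ ∑-cong (points ⊗ points) (λ (s , t) → constant s t) ⟩
      ∑ (points ⊗ points) (λ (s , t) → τ J s t * replication s₀ t₀)
        ≡⟨ ∑-*ʳ (points ⊗ points) (replication s₀ t₀) (λ (s , t) → τ J s t) ⟩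
      ∑ points (λ s → ∑ points (τ J s)) * replication s₀ t₀
        ≡⟨ cong (_* replication s₀ t₀) (trans (∑-cong points (∑-τ J)) (∑-const points (neighbours J))) ⟩
      size points * neighbours J * replication s₀ t₀ ∎
      where
      constant : ∀ s t → τ J s t * replication s t ≡ τ J s t * replication s₀ t₀
      constant s t with τ-nonzero J s t
      ... | inj₁ τ≡0 rewrite τ≡0 = refl
      ... | inj₂ same = cong (τ J s t *_) (replication-agreement s t s₀ t₀ (trans same (sym J≡)))

    block-card : ∀ X → X ∈ Block → HasCardinality (subsetoid (setoid (El points)) X) k
    block-card X (g , _ , X⊆gB , gB⊆X) = mkInverse
      (λ i → Inverse.to g (pt i) , gB⊆X (pt i , sound i , refl))
      (cong (Inverse.to g ∘ pt))
      (injective ∘ to-injective g)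
      (λ (s , s∈X) → let x , x∈B , gx≡s = X⊆gB s∈X ; i , i≡x = complete x∈B
                     in i , trans (cong (Inverse.to g) i≡x) gx≡s)

    is2Design : .{{_ : NonZero (size points)}} →
      (∀ J → J ≢ (true , true , true) → pairCount J ≡ neighbours J) →
      Is2Design (𝒟 B group) (size points) k (blockCount / size points)
    is2Design pairs≡ = record
      { points = enumeration points
      ; blocks = block-card
      ; pairs  = λ s t s≢t → subst (HasCardinality _) (replication≡ s t s≢t) (blocksThrough-card s t)
      }
      where
      replication≡ : ∀ s t → s ≢ t → replication s t ≡ blockCount / size points
      replication≡ s t s≢t = begin
        replication s t                              ≡⟨ m*n/n≡m (replication s t) (size points) ⟨
        replication s t * size points / size points  ≡⟨ cong (_/ size points) (sym count) ⟩
        blockCount / size points                     ∎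
        where
        A = agreement s t
        -- A type that occurs has a neighbour: `t` itself contributes 1 to the sum that counts the
        -- neighbours of `s`.
        positive : NonZero (neighbours A)
        positive = ≢-nonZero λ A≡0 → contradiction
          (trans (sym (τ-agreement s t)) (∑≡0⇒≡0 points (trans (∑-τ A s) A≡0) t)) 1+n≢0
        count : blockCount ≡ replication s t * size points
        count = *-cancelʳ-≡ _ _ (neighbours A) {{positive}} (begin
          blockCount * neighbours A                        ≡⟨ cong (blockCount *_) (pairs≡ A (s≢t ∘ agreement-full s t)) ⟨
          blockCount * pairCount A                         ≡⟨ double-count A s t refl ⟩
          size points * neighbours A * replication s t     ≡⟨ *-comm _ (replication s t) ⟩
          replication s t * (size points * neighbours A)   ≡⟨ *-assoc (replication s t) _ _ ⟨
          replication s t * size points * neighbours A     ∎)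

-- Counting agreements

-- α b requires agreement or nothing, χ′ b requires agreement or disagreement.
α : Bool → ℕ → ℕ → ℕ
α true  m n = 𝟙 (m ≟ n)
α false m n = 1

χ′ : Bool → ℕ → ℕ → ℕ
χ′ b m n = 𝟙 (does (m ≟ n) Boolₚ.≟ b)

α-true : ∀ m n → α true m n ≡ χ′ true m n
α-true m n with does (m ≟ n)
... | true  = refl
... | false = refl

α-false : ∀ m n → α false m n ≡ χ′ true m n + χ′ false m n
α-false m n with does (m ≟ n)
... | true  = refl
... | false = refl

free : Bool → ℕ → ℕ
free true  e = 1
free false e = e

-- One step of inclusion-exclusion without subtraction. The pairs with no condition on a coordinate
-- (`a`) are those that agree in it (`e`) and those that differ in it (`d`), and (f + 1)g - g = fg;
-- the excess `r` cancels.
cancel-agreeing : ∀ r f g {a e d} → a ≡ e + d → a ≡ r + suc f * g → e ≡ r + g → d ≡ f * g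
cancel-agreeing r f g refl a≡ refl = +-cancelˡ-≡ (r + g) _ _ (trans a≡ (sym (+-assoc r g (f * g))))

Weight : Set
Weight = ℕ → ℕ → ℕ

-- Inclusion–exclusion, one coordinate at a time.
module PairCounts (I : Code) (x y z : El I → ℕ) where

  S : Weight → Weight → Weight → ℕ
  S k₁ k₂ k₃ = ∑ (I ⊗ I) λ (i , j) → k₁ (x i) (x j) * (k₂ (y i) (y j) * k₃ (z i) (z j))

  S-true₁ : ∀ k₂ k₃ → S (χ′ true) k₂ k₃ ≡ S (α true) k₂ k₃
  S-true₁ k₂ k₃ = ∑-cong (I ⊗ I) λ (i , j) →
    cong (_* (k₂ (y i) (y j) * k₃ (z i) (z j))) (sym (α-true (x i) (x j)))

  S-true₂ : ∀ k₁ k₃ → S k₁ (χ′ true) k₃ ≡ S k₁ (α true) k₃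
  S-true₂ k₁ k₃ = ∑-cong (I ⊗ I) λ (i , j) →
    cong (λ w → k₁ (x i) (x j) * (w * k₃ (z i) (z j))) (sym (α-true (y i) (y j)))

  S-true₃ : ∀ k₁ k₂ → S k₁ k₂ (χ′ true) ≡ S k₁ k₂ (α true)
  S-true₃ k₁ k₂ = ∑-cong (I ⊗ I) λ (i , j) →
    cong (λ w → k₁ (x i) (x j) * (k₂ (y i) (y j) * w)) (sym (α-true (z i) (z j)))

  S-split₁ : ∀ k₂ k₃ → S (α false) k₂ k₃ ≡ S (χ′ true) k₂ k₃ + S (χ′ false) k₂ k₃
  S-split₁ k₂ k₃ = trans
    (∑-cong (I ⊗ I) λ (i , j) → trans
      (cong (_* (k₂ (y i) (y j) * k₃ (z i) (z j))) (α-false (x i) (x j)))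
      (*-distribʳ-+ (k₂ (y i) (y j) * k₃ (z i) (z j)) (χ′ true (x i) (x j)) (χ′ false (x i) (x j))))
    (∑-+ (I ⊗ I) (λ (i , j) → χ′ true (x i) (x j) * (k₂ (y i) (y j) * k₃ (z i) (z j))) _)

  S-split₂ : ∀ k₁ k₃ → S k₁ (α false) k₃ ≡ S k₁ (χ′ true) k₃ + S k₁ (χ′ false) k₃
  S-split₂ k₁ k₃ = trans
    (∑-cong (I ⊗ I) λ (i , j) → trans
      (cong (λ w → k₁ (x i) (x j) * (w * k₃ (z i) (z j))) (α-false (y i) (y j)))
      (distrib (k₁ (x i) (x j)) (χ′ true (y i) (y j)) (χ′ false (y i) (y j)) _))
    (∑-+ (I ⊗ I) (λ (i , j) → k₁ (x i) (x j) * (χ′ true (y i) (y j) * k₃ (z i) (z j))) _)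
    where
    distrib : ∀ t u v w → t * ((u + v) * w) ≡ t * (u * w) + t * (v * w)
    distrib = solve-∀

  S-split₃ : ∀ k₁ k₂ → S k₁ k₂ (α false) ≡ S k₁ k₂ (χ′ true) + S k₁ k₂ (χ′ false)
  S-split₃ k₁ k₂ = trans
    (∑-cong (I ⊗ I) λ (i , j) → trans
      (cong (λ w → k₁ (x i) (x j) * (k₂ (y i) (y j) * w)) (α-false (z i) (z j)))
      (distrib (k₁ (x i) (x j)) (k₂ (y i) (y j)) (χ′ true (z i) (z j)) (χ′ false (z i) (z j))))
    (∑-+ (I ⊗ I) (λ (i , j) → k₁ (x i) (x j) * (k₂ (y i) (y j) * χ′ true (z i) (z j))) _)
    where
    distrib : ∀ t u v w → t * (u * (v + w)) ≡ t * (u * v) + t * (u * w)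
    distrib = solve-∀

  module _ (q f₁ f₂ f₃ : ℕ)
    (agreeing : ∀ b₁ b₂ b₃ → S (α b₁) (α b₂) (α b₃) ≡
      q + free b₁ (suc f₁) * (free b₂ (suc f₂) * free b₃ (suc f₃))) where

    -- Pairs of equal points drop out as soon as one coordinate is required to differ, and the
    -- excess goes with them.
    rest : Bool → ℕ
    rest true  = q
    rest false = 0

    exact₁ : ∀ b₁ b₂ b₃ → S (χ′ b₁) (α b₂) (α b₃) ≡
      rest b₁ + factor b₁ (suc f₁) * (free b₂ (suc f₂) * free b₃ (suc f₃))
    exact₁ true  b₂ b₃ = trans (S-true₁ (α b₂) (α b₃)) (agreeing true b₂ b₃)
    exact₁ false b₂ b₃ = cancel-agreeing q f₁ (free b₂ (suc f₂) * free b₃ (suc f₃))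
      (S-split₁ (α b₂) (α b₃))
      (agreeing false b₂ b₃)
      (trans (exact₁ true b₂ b₃) (cong (q +_) (*-identityˡ _)))

    exact₂ : ∀ b₁ b₂ b₃ → S (χ′ b₁) (χ′ b₂) (α b₃) ≡
      rest (b₁ ∧ b₂) + factor b₁ (suc f₁) * (factor b₂ (suc f₂) * free b₃ (suc f₃))
    exact₂ b₁ true b₃ rewrite Boolₚ.∧-identityʳ b₁ =
      trans (S-true₂ (χ′ b₁) (α b₃)) (exact₁ b₁ true b₃)
    exact₂ b₁ false b₃ rewrite Boolₚ.∧-zeroʳ b₁ = trans
      (cancel-agreeing (rest b₁) f₂ (u * w)
        (S-split₂ (χ′ b₁) (α b₃))
        (trans (exact₁ b₁ false b₃) (cong (rest b₁ +_) (shuffle u (suc f₂) w)))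
        (trans (S-true₂ (χ′ b₁) (α b₃)) (trans (exact₁ b₁ true b₃)
          (cong (λ v → rest b₁ + u * v) (*-identityˡ w)))))
      (sym (shuffle u f₂ w))
      where
      u = factor b₁ (suc f₁)
      w = free b₃ (suc f₃)
      shuffle : ∀ u v w → u * (v * w) ≡ v * (u * w)
      shuffle = solve-∀

    exact₃ : ∀ b₁ b₂ b₃ → S (χ′ b₁) (χ′ b₂) (χ′ b₃) ≡
      rest ((b₁ ∧ b₂) ∧ b₃) + factor b₁ (suc f₁) * (factor b₂ (suc f₂) * factor b₃ (suc f₃))
    exact₃ b₁ b₂ true rewrite Boolₚ.∧-identityʳ (b₁ ∧ b₂) =
      trans (S-true₃ (χ′ b₁) (χ′ b₂)) (exact₂ b₁ b₂ true)
    exact₃ b₁ b₂ false rewrite Boolₚ.∧-zeroʳ (b₁ ∧ b₂) = trans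
      (cancel-agreeing (rest (b₁ ∧ b₂)) f₃ (u * v)
        (S-split₃ (χ′ b₁) (χ′ b₂))
        (trans (exact₂ b₁ b₂ false) (cong (rest (b₁ ∧ b₂) +_) (shuffle u v (suc f₃))))
        (trans (S-true₃ (χ′ b₁) (χ′ b₂)) (trans (exact₂ b₁ b₂ true)
          (cong (λ v → rest (b₁ ∧ b₂) + u * v) (*-identityʳ v)))))
      (sym (shuffle u v f₃))
      where
      u = factor b₁ (suc f₁)
      v = factor b₂ (suc f₂)
      shuffle : ∀ u v w → u * (v * w) ≡ w * (u * v)
      shuffle = solve-∀

    -- As some bit is `false`, `rest` reduces to 0; the cases are split just far enough for `_∧_` to
    -- compute.
    exact : ∀ b₁ b₂ b₃ → (b₁ , b₂ , b₃) ≢ (true , true , true) → S (χ′ b₁) (χ′ b₂) (χ′ b₃) ≡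
      factor b₁ (suc f₁) * (factor b₂ (suc f₂) * factor b₃ (suc f₃))
    exact true  true  true  b≢ = contradiction refl b≢
    exact true  true  false _  = exact₃ true true false
    exact true  false b₃    _  = exact₃ true false b₃
    exact false b₂    b₃    _  = exact₃ false b₂ b₃

-- The excess, one less than the size of B, is there because pairs of equal points are counted too.
record Parametrisation (B : Pred (ℕ × ℕ × ℕ) 0ℓ) (E₁ E₂ E₃ : ℕ) : Set where
  field
    I           : Code
    x y z       : El I → ℕ
    x<          : ∀ i → x i < E₁
    y<          : ∀ i → y i < E₂
    z<          : ∀ i → z i < E₃
    sound       : ∀ i → B (x i , y i , z i)
    complete    : ∀ {t} → B t → ∃ λ i → (x i , y i , z i) ≡ t
    separated   : ∀ i j → x i ≡ x j → y i ≡ y j → z i ≡ z j → i ≡ j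
    excess      : ℕ
    agreeing    : ∀ b₁ b₂ b₃ → PairCounts.S I x y z (α b₁) (α b₂) (α b₃) ≡
                    excess + free b₁ E₁ * (free b₂ E₂ * free b₃ E₃)

module FromParametrisation {B : Pred (ℕ × ℕ × ℕ) 0ℓ} {f₁ f₂ f₃ : ℕ}
                           (π : Parametrisation B (suc f₁) (suc f₂) (suc f₃)) where
  open Parametrisation π
  open PointGrid (suc f₁) (suc f₂) (suc f₃)
  open PairCounts I x y z

  B′ : Pred (El points) 0ℓ
  B′ (a , b , c) = B (toℕ a , toℕ b , toℕ c)

  point : El I → El points
  point i = fromℕ< (x< i) , fromℕ< (y< i) , fromℕ< (z< i)

  φ : Fin (size I) ↔ El I
  φ = enumeration I

  point-injective : ∀ {i j} → point i ≡ point j → i ≡ j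
  point-injective {i} {j} eq = separated i j
    (Finₚ.fromℕ<-injective _ _ (x< i) (x< j) (cong proj₁ eq))
    (Finₚ.fromℕ<-injective _ _ (y< i) (y< j) (cong (proj₁ ∘ proj₂) eq))
    (Finₚ.fromℕ<-injective _ _ (z< i) (z< j) (cong (proj₂ ∘ proj₂) eq))

  point-sound : ∀ i → point i ∈ B′
  point-sound i rewrite Finₚ.toℕ-fromℕ< (x< i) | Finₚ.toℕ-fromℕ< (y< i) | Finₚ.toℕ-fromℕ< (z< i) = sound i

  point-complete : ∀ {s} → s ∈ B′ → ∃ λ i → point i ≡ s
  point-complete {a , b , c} s∈B with i , eq ← complete s∈B =
    i , cong₂ _,_ (coord (x< i) (cong proj₁ eq))
          (cong₂ _,_ (coord (y< i) (cong (proj₁ ∘ proj₂) eq)) (coord (z< i) (cong (proj₂ ∘ proj₂) eq)))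
    where
    coord : ∀ {m n} {a : Fin n} (m<n : m < n) → m ≡ toℕ a → fromℕ< m<n ≡ a
    coord m<n m≡a = Finₚ.toℕ-injective (trans (Finₚ.toℕ-fromℕ< m<n) m≡a)

  enumerates : Enumerates (point ∘ Inverse.to φ) B′
  enumerates = record
    { injective = to-injective φ ∘ point-injective
    ; sound     = point-sound ∘ Inverse.to φ
    ; complete  = λ s∈B → let i , eq = point-complete s∈B
                          in Inverse.from φ i , trans (cong point (Inverse.strictlyInverseˡ φ i)) eq
    }

  open Orbit (point ∘ Inverse.to φ) B′ enumerates using (pairCount; blockCount; is2Design)

  χ-fromℕ< : ∀ b {m n e} (m<e : m < e) (n<e : n < e) → χ b (fromℕ< m<e) (fromℕ< n<e) ≡ χ′ b m n
  χ-fromℕ< b {m} {n} m<e n<e = cong (λ d → 𝟙 (d Boolₚ.≟ b)) (does-⇔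
    (mk⇔ (Finₚ.fromℕ<-injective _ _ m<e n<e) (λ m≡n → Finₚ.fromℕ<-cong m n m≡n m<e n<e))
    (fromℕ< m<e Finₚ.≟ fromℕ< n<e) (m ≟ n))

  pairCount≡S : ∀ b₁ b₂ b₃ → pairCount (b₁ , b₂ , b₃) ≡ S (χ′ b₁) (χ′ b₂) (χ′ b₃)
  pairCount≡S b₁ b₂ b₃ = begin
    pairCount (b₁ , b₂ , b₃)
      ≡⟨ ∑-reindex (fin (size I) ⊗ fin (size I)) (I ⊗ I) (φ ×-↔ φ)
           (λ (i , j) → τ (b₁ , b₂ , b₃) (point i) (point j)) ⟨
    ∑ (I ⊗ I) (λ (i , j) → τ (b₁ , b₂ , b₃) (point i) (point j))
      ≡⟨ ∑-cong (I ⊗ I) (λ (i , j) → cong₂ _*_ (χ-fromℕ< b₁ (x< i) (x< j))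
           (cong₂ _*_ (χ-fromℕ< b₂ (y< i) (y< j)) (χ-fromℕ< b₃ (z< i) (z< j)))) ⟩
    S (χ′ b₁) (χ′ b₂) (χ′ b₃) ∎

  design : ∃ λ ƛ → Is2Design (𝒟 B′ group) (size points) (size I) ƛ
  design = blockCount / size points , is2Design λ { (b₁ , b₂ , b₃) J≢ →
    trans (pairCount≡S b₁ b₂ b₃) (exact excess f₁ f₂ f₃ agreeing b₁ b₂ b₃ J≢) }

-- Matching on the positivity proofs turns the sizes into successors, the form in which `exact` can
-- express each e - 1 as a variable.
parametrised-design : ∀ {B E₁ E₂ E₃} (π : Parametrisation B E₁ E₂ E₃) → 0 < E₁ → 0 < E₂ → 0 < E₃ →
  ∃ λ ƛ → Is2Design (𝒟 (λ (x , y , z) → B (toℕ x , toℕ y , toℕ z)) (Sym³ (Fin E₁) (Fin E₂) (Fin E₃)))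
            (E₁ * (E₂ * E₃)) (size (Parametrisation.I π)) ƛ
parametrised-design π (s≤s z≤n) (s≤s z≤n) (s≤s z≤n) = FromParametrisation.design π

-- Coordinates of the base block are positions in an enumeration: `index-injective` then separates
-- points, `index<size` bounds the coordinate, and `∑-𝟙-index` says that every value below the size
-- is taken once.
index : ∀ c → El c → ℕ
index c i = toℕ (Inverse.from (enumeration c) i)

index-injective : ∀ c {i j} → index c i ≡ index c j → i ≡ j
index-injective c eq = to-injective (↔-sym (enumeration c)) (Finₚ.toℕ-injective eq)

index<size : ∀ c i → index c i < size c
index<size c i = Finₚ.toℕ<n _

index-surjective : ∀ c {k} → k < size c → ∃ λ i → index c i ≡ k
index-surjective c k< = Inverse.to (enumeration c) (fromℕ< k<) ,
  trans (cong toℕ (Inverse.strictlyInverseʳ (enumeration c) (fromℕ< k<))) (Finₚ.toℕ-fromℕ< k<)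

index-inj₁ : ∀ c d i → index (c ⊕ d) (inj₁ i) ≡ index c i
index-inj₁ c d i = Finₚ.toℕ-↑ˡ _ (size d)

index-inj₂ : ∀ c d j → index (c ⊕ d) (inj₂ j) ≡ size c + index d j
index-inj₂ c d j = Finₚ.toℕ-↑ʳ (size c) _

index-⊗ : ∀ c d i j → index (c ⊗ d) (i , j) ≡ size d * index c i + index d j
index-⊗ c d i j = Finₚ.toℕ-combine (Inverse.from (enumeration c) i) (Inverse.from (enumeration d) j)

𝟙-index : ∀ c (i j : El c) → 𝟙 (index c i ≟ index c j) ≡ 𝟙 (_≟ᴱ_ {c} i j)
𝟙-index c i j = 𝟙-⇔ (mk⇔ (index-injective c) (cong (index c))) (index c i ≟ index c j) (_≟ᴱ_ {c} i j)

∑-𝟙-index : ∀ c {k} → k < size c → ∑ c (λ i → 𝟙 (k ≟ index c i)) ≡ 1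
∑-𝟙-index c {k} k< with i , refl ← index-surjective c k< =
  ∑-𝟙₁ c (λ j → index c i ≟ index c j) {i} refl (λ eq → index-injective c (sym eq))

α-refl : ∀ b n → α b n n ≡ 1
α-refl true  n = 𝟙-yes (n ≟ n) refl
α-refl false n = refl

-- A base block consisting of c-many points with z = 0 and of pairs of points, one pair for each
-- element of d, that differ only in z; distinct points outside the plane z = 0 have distinct z.
module TwinPairs (c d : Code) (x y : El (c ⊕ d) → ℕ) where

  I : Code
  I = c ⊕ d ⊗ fin 2

  cell : El I → El (c ⊕ d)
  cell (inj₁ u)       = inj₁ u
  cell (inj₂ (w , _)) = inj₂ w

  z : El I → ℕ
  z (inj₁ _) = 0
  -- The value 0 is reserved for the plane. The factor `fin 2` varies fastest, so the twins over the
  -- cell with index q get 2q + 1 and 2q + 2.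
  z (inj₂ v) = suc (index (d ⊗ fin 2) v)

  open PairCounts I (x ∘ cell) (y ∘ cell) z

  -- Sums over points become sums over cells: a cell in the plane carries one point, any other cell
  -- carries two.
  ∑₂ : (El (c ⊕ d) → ℕ) → ℕ
  ∑₂ f = ∑ c (f ∘ inj₁) + 2 * ∑ d (f ∘ inj₂)

  ∑-cell : ∀ f → ∑ I (f ∘ cell) ≡ ∑₂ f
  ∑-cell f = cong (∑ c (f ∘ inj₁) +_) (∑-*ˡ d 2 (f ∘ inj₂))

  ∑₂-cong : ∀ {f g} → f ≗ g → ∑₂ f ≡ ∑₂ g
  ∑₂-cong f≗g = cong₂ (λ u v → u + 2 * v) (∑-cong c (f≗g ∘ inj₁)) (∑-cong d (f≗g ∘ inj₂))

  κ : Bool → Bool → El (c ⊕ d) → El (c ⊕ d) → ℕ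
  κ b₁ b₂ i j = α b₁ (x i) (x j) * α b₂ (y i) (y j)

  S-free : ∀ b₁ b₂ → S (α b₁) (α b₂) (α false) ≡ ∑₂ (λ i → ∑₂ (κ b₁ b₂ i))
  S-free b₁ b₂ = begin
    S (α b₁) (α b₂) (α false)
      ≡⟨ ∑-cong (I ⊗ I) {g = λ (i , j) → κ b₁ b₂ (cell i) (cell j)}
           (λ (i , j) → cong (α b₁ (x (cell i)) (x (cell j)) *_) (*-identityʳ (α b₂ (y (cell i)) (y (cell j))))) ⟩
    ∑ I (λ i → ∑ I λ j → κ b₁ b₂ (cell i) (cell j))
      ≡⟨ ∑-cong I (λ i → ∑-cell (κ b₁ b₂ (cell i))) ⟩
    ∑ I (λ i → ∑₂ (κ b₁ b₂ (cell i)))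
      ≡⟨ ∑-cell (λ i → ∑₂ (κ b₁ b₂ i)) ⟩
    ∑₂ (λ i → ∑₂ (κ b₁ b₂ i)) ∎

  -- Outside the plane a point agrees in z with itself only, which gives one pair per twin whatever
  -- is required of x and y.
  S-agree : ∀ b₁ b₂ → S (α b₁) (α b₂) (α true) ≡
    ∑ c (λ u → ∑ c λ u′ → κ b₁ b₂ (inj₁ u) (inj₁ u′)) + size d * 2
  S-agree b₁ b₂ = cong₂ _+_ (∑-cong c plane) (trans (∑-cong (d ⊗ fin 2) pair) (∑-1 (d ⊗ fin 2)))
    where
    k : El I → El I → ℕ
    k i j = α b₁ (x (cell i)) (x (cell j)) * (α b₂ (y (cell i)) (y (cell j)) * α true (z i) (z j))

    k-zero : ∀ i j → z i ≢ z j → k i j ≡ 0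
    k-zero i j z≢ = begin
      k i j ≡⟨ cong (λ w → α b₁ _ _ * (α b₂ _ _ * w)) (𝟙-no (z i ≟ z j) z≢) ⟩
      α b₁ (x (cell i)) (x (cell j)) * (α b₂ (y (cell i)) (y (cell j)) * 0)
            ≡⟨ cong (α b₁ (x (cell i)) (x (cell j)) *_) (*-zeroʳ (α b₂ (y (cell i)) (y (cell j)))) ⟩
      α b₁ (x (cell i)) (x (cell j)) * 0
            ≡⟨ *-zeroʳ (α b₁ (x (cell i)) (x (cell j))) ⟩
      0     ∎

    k-refl : ∀ i → k i i ≡ 1
    k-refl i rewrite α-refl b₁ (x (cell i)) | α-refl b₂ (y (cell i)) | 𝟙-yes (z i ≟ z i) refl = refl

    plane : ∀ u → ∑ I (k (inj₁ u)) ≡ ∑ c (λ u′ → κ b₁ b₂ (inj₁ u) (inj₁ u′))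
    plane u = trans (cong₂ _+_ (∑-cong c λ u′ → cong (α b₁ (x (inj₁ u)) (x (inj₁ u′)) *_)
                                                     (*-identityʳ (α b₂ (y (inj₁ u)) (y (inj₁ u′)))))
                               (∑-zero (d ⊗ fin 2) λ v → k-zero (inj₁ u) (inj₂ v) λ ()))
                    (+-identityʳ _)

    pair : ∀ v → ∑ I (k (inj₂ v)) ≡ 1
    pair v = trans (∑-single I {k (inj₂ v)} (inj₂ v) λ where
                     (inj₁ u)  _ → k-zero (inj₂ v) (inj₁ u) λ ()
                     (inj₂ v′) v′≢ → k-zero (inj₂ v) (inj₂ v′) λ eq →
                       v′≢ (cong inj₂ (index-injective (d ⊗ fin 2) (sym (suc-injective eq)))))
                   (k-refl (inj₂ v))

-- The columns and rows of the base block

pattern at₁ i = inj₁ i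
pattern at₂ i = inj₂ (inj₁ i)
pattern at₃ i = inj₂ (inj₂ (inj₁ i))
pattern at₄ i = inj₂ (inj₂ (inj₂ i))

module _ (c₁ c₂ c₃ c₄ : Code) where

  index-at₁ : ∀ i → index (c₁ ⊕ c₂ ⊕ c₃ ⊕ c₄) (at₁ i) ≡ index c₁ i
  index-at₁ i = index-inj₁ c₁ (c₂ ⊕ c₃ ⊕ c₄) i

  index-at₂ : ∀ i → index (c₁ ⊕ c₂ ⊕ c₃ ⊕ c₄) (at₂ i) ≡ size c₁ + index c₂ i
  index-at₂ i = trans (index-inj₂ c₁ (c₂ ⊕ c₃ ⊕ c₄) (inj₁ i)) (cong (size c₁ +_) (index-inj₁ c₂ (c₃ ⊕ c₄) i))

  index-at₃ : ∀ i → index (c₁ ⊕ c₂ ⊕ c₃ ⊕ c₄) (at₃ i) ≡ size c₁ + (size c₂ + index c₃ i)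
  index-at₃ i = trans (index-inj₂ c₁ (c₂ ⊕ c₃ ⊕ c₄) (inj₂ (inj₁ i))) (cong (size c₁ +_)
    (trans (index-inj₂ c₂ (c₃ ⊕ c₄) (inj₁ i)) (cong (size c₂ +_) (index-inj₁ c₃ c₄ i))))

  index-at₄ : ∀ i → index (c₁ ⊕ c₂ ⊕ c₃ ⊕ c₄) (at₄ i) ≡ size c₁ + (size c₂ + (size c₃ + index c₄ i))
  index-at₄ i = trans (index-inj₂ c₁ (c₂ ⊕ c₃ ⊕ c₄) (inj₂ (inj₂ i))) (cong (size c₁ +_)
    (trans (index-inj₂ c₂ (c₃ ⊕ c₄) (inj₂ i)) (cong (size c₂ +_) (index-inj₂ c₃ c₄ i))))

∑-𝟙-≟ : ∀ c i → ∑ c (λ j → 𝟙 (_≟ᴱ_ {c} i j)) ≡ 1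
∑-𝟙-≟ c i = ∑-𝟙₁ c (_≟ᴱ_ {c} i) refl sym

∑-𝟙-≟ˡ : ∀ c d i → ∑ (c ⊗ d) (λ (j , _) → 𝟙 (_≟ᴱ_ {c} i j)) ≡ size d
∑-𝟙-≟ˡ c d i = begin
  ∑ c (λ j → ∑ d λ _ → 𝟙 (_≟ᴱ_ {c} i j))        ≡⟨ ∑-cong c (λ j → trans (∑-const d (𝟙 (_≟ᴱ_ {c} i j)))
                                                                          (*-comm (size d) _)) ⟩
  ∑ c (λ j → 𝟙 (_≟ᴱ_ {c} i j) * size d)         ≡⟨ ∑-*ʳ c (size d) (λ j → 𝟙 (_≟ᴱ_ {c} i j)) ⟩
  ∑ c (λ j → 𝟙 (_≟ᴱ_ {c} i j)) * size d         ≡⟨ cong (_* size d) (∑-𝟙-≟ c i) ⟩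
  1 * size d                                    ≡⟨ *-identityˡ (size d) ⟩
  size d                                        ∎

∑-𝟙-≟ʳ : ∀ c d i → ∑ (d ⊗ c) (λ (_ , j) → 𝟙 (_≟ᴱ_ {c} i j)) ≡ size d
∑-𝟙-≟ʳ c d i = trans (∑-cong d λ _ → ∑-𝟙-≟ c i) (∑-1 d)

side : Bool → {A : Set} → A → A ⊎ A
side false = inj₁
side true  = inj₂

side-surjective : {A : Set} (t : A ⊎ A) → ∃₂ λ s a → side s a ≡ t
side-surjective (inj₁ a) = false , a , refl
side-surjective (inj₂ a) = true , a , refl

side-injective : {A : Set} (s s′ : Bool) {a a′ : A} → side s a ≡ side s′ a′ → s ≡ s′ × a ≡ a′
side-injective false false refl = refl , refl
side-injective true  true  refl = refl , refl

∑-factors : ∀ s n → 0 < n → factor s n + factor (not s) n ≡ n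
∑-factors true  (suc n) _ = refl
∑-factors false (suc n) _ = +-comm n 1

half : ∀ {n} → Fin n → Fin n
half b = fromℕ< (≤-<-trans (⌊n/2⌋≤n (toℕ b)) (Finₚ.toℕ<n b))

-- c and d₁, …, d₄ stand for B′ and B₃₁, …, B₃₄ with the parameters of the paper lowered by one and written
-- as (b , a), so that the lexicographic index of a pair determines its z.
module Columns (p n m m′ : ℕ) (0<n : 0 < n) where

  c d d₁ d₂ d₃ d₄ X Y₂ Yₙ Yₘ : Code
  c  = fin (suc p) ⊕ fin n ⊗ fin 2
  d₁ = fin m ⊗ fin p
  d₂ = fin n ⊗ fin n
  d₃ = fin m′ ⊗ fin p
  d₄ = fin n ⊗ fin n
  d  = d₁ ⊕ d₂ ⊕ d₃ ⊕ d₄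
  X  = fin (suc p) ⊕ fin n ⊕ fin p ⊕ fin n
  Y₂ = fin n ⊗ fin 2
  Yₙ = fin n ⊕ fin n
  Yₘ = fin m ⊕ fin m′

  origin : Fin n
  origin = fromℕ< 0<n

  column : El (c ⊕ d) → El X
  column (inj₁ (inj₁ a))         = at₁ a
  column (inj₁ (inj₂ (a , _)))   = at₂ a
  -- Column 0 keeps its plane point alone, since the first family starts at a = 1.
  column (inj₂ (at₁ (_ , a)))    = at₁ (suc a)
  column (inj₂ (at₂ (_ , a)))    = at₂ a
  column (inj₂ (at₃ (_ , a)))    = at₃ a
  column (inj₂ (at₄ (_ , a)))    = at₄ a

  -- With both indices lowered by one, the condition b ∈ {2a - 1, 2a} in `δ₂` becomes ⌊b/2⌋ = a,
  -- which makes the shifted column a function of b; the condition a = 1 in `δ₄` becomes a = 0.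
  shift₂ shift₄ : Fin n → Fin n → Bool
  shift₂ b a = does (half b Finₚ.≟ a)
  shift₄ b a = not (does (origin Finₚ.≟ a))

  -- The 2n rows other than row 0 are numbered by three codes: `Y₂` for the plane, which puts two
  -- consecutive rows in each column; `Yₙ` for two halves between which a shift moves a pair; `Yₘ`
  -- for the two families without shifts, which fill m and m′ rows.
  x y : El (c ⊕ d) → ℕ
  x i = index X (column i)
  y (inj₁ (inj₁ _))       = 0
  y (inj₁ (inj₂ v))       = suc (index Y₂ v)
  y (inj₂ (at₁ (b , _)))  = suc (index Yₘ (inj₁ b))
  y (inj₂ (at₂ (b , a)))  = suc (index Yₙ (side (shift₂ b a) b))
  y (inj₂ (at₃ (b , _)))  = suc (index Yₘ (inj₂ b))
  y (inj₂ (at₄ (b , a)))  = suc (index Yₙ (side (shift₄ b a) b))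

  open TwinPairs c d x y

  planeInColumn pairsInColumn : El X → ℕ
  planeInColumn (at₁ _) = 1
  planeInColumn (at₂ _) = 2
  planeInColumn (at₃ _) = 0
  planeInColumn (at₄ _) = 0
  pairsInColumn (at₁ zero)    = 0
  pairsInColumn (at₁ (suc _)) = m
  pairsInColumn (at₂ _)       = n
  pairsInColumn (at₃ _)       = m′
  pairsInColumn (at₄ _)       = n

  ∑-planeInColumn : ∀ s → ∑ c (λ u → 𝟙 (_≟ᴱ_ {X} s (column (inj₁ u)))) ≡ planeInColumn s
  ∑-planeInColumn (at₁ a) = cong₂ _+_ (∑-𝟙-≟ (fin (suc p)) a) (∑-0 Y₂)
  ∑-planeInColumn (at₂ a) = cong₂ _+_ (∑-0 (fin (suc p))) (∑-𝟙-≟ˡ (fin n) (fin 2) a)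
  ∑-planeInColumn (at₃ a) = cong₂ _+_ (∑-0 (fin (suc p))) (∑-0 Y₂)
  ∑-planeInColumn (at₄ a) = cong₂ _+_ (∑-0 (fin (suc p))) (∑-0 Y₂)

  ∑-pairsInColumn : ∀ s → ∑ d (λ w → 𝟙 (_≟ᴱ_ {X} s (column (inj₂ w)))) ≡ pairsInColumn s
  ∑-pairsInColumn (at₁ zero) = cong₂ _+_ (∑-0 d₁) (cong₂ _+_ (∑-0 d₂) (cong₂ _+_ (∑-0 d₃) (∑-0 d₄)))
  ∑-pairsInColumn (at₁ (suc a)) =
    trans (cong₂ _+_ (∑-𝟙-≟ʳ (fin p) (fin m) a) (cong₂ _+_ (∑-0 d₂) (cong₂ _+_ (∑-0 d₃) (∑-0 d₄)))) (+-identityʳ m)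
  ∑-pairsInColumn (at₂ a) =
    trans (cong₂ _+_ (∑-0 d₁) (cong₂ _+_ (∑-𝟙-≟ʳ (fin n) (fin n) a) (cong₂ _+_ (∑-0 d₃) (∑-0 d₄)))) (+-identityʳ n)
  ∑-pairsInColumn (at₃ a) =
    trans (cong₂ _+_ (∑-0 d₁) (cong₂ _+_ (∑-0 d₂) (cong₂ _+_ (∑-𝟙-≟ʳ (fin p) (fin m′) a) (∑-0 d₄)))) (+-identityʳ m′)
  ∑-pairsInColumn (at₄ a) =
    cong₂ _+_ (∑-0 d₁) (cong₂ _+_ (∑-0 d₂) (cong₂ _+_ (∑-0 d₃) (∑-𝟙-≟ʳ (fin n) (fin n) a)))

  κ-x : ∀ i j → κ true false i j ≡ 𝟙 (_≟ᴱ_ {X} (column i) (column j))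
  κ-x i j = trans (*-identityʳ _) (𝟙-index X (column i) (column j))

  -- Every point contributes the size of its column. This is 1 for column 0 and 1 + 2m, 2 + 2n, 2m′,
  -- 2n in the four groups of columns.
  S-x : PairCounts.S I (x ∘ cell) (y ∘ cell) z (α true) (α false) (α false) ≡
    ((1 + p * (1 + 2 * m)) + n * 2 * (2 + 2 * n)) +
    2 * (m * p * (1 + 2 * m) + (n * n * (2 + 2 * n) + (m′ * p * (2 * m′) + n * n * (2 * n))))
  S-x = begin
    _ ≡⟨ S-free true false ⟩
    ∑₂ (λ i → ∑₂ (κ true false i))
      ≡⟨ ∑₂-cong (λ i → trans (∑₂-cong (κ-x i))
           (cong₂ (λ u v → u + 2 * v) (∑-planeInColumn (column i)) (∑-pairsInColumn (column i)))) ⟩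
    ∑₂ (λ i → planeInColumn (column i) + 2 * pairsInColumn (column i))
      ≡⟨ cong₂ (λ u v → u + 2 * v)
           (cong₂ _+_ (cong suc (∑-const (fin p) (1 + 2 * m))) (∑-const Y₂ (2 + 2 * n)))
           (cong₂ _+_ (∑-const d₁ (1 + 2 * m)) (cong₂ _+_ (∑-const d₂ (2 + 2 * n))
             (cong₂ _+_ (∑-const d₃ (2 * m′)) (∑-const d₄ (2 * n))))) ⟩
    _ ∎

  S-xz : PairCounts.S I (x ∘ cell) (y ∘ cell) z (α true) (α false) (α true) ≡
    (suc p * 1 + n * 2 * 2) + size d * 2
  S-xz = trans (S-agree true false) (cong (_+ size d * 2) (trans
    (∑-cong c λ u → trans (∑-cong c λ u′ → κ-x (inj₁ u) (inj₁ u′)) (∑-planeInColumn (column (inj₁ u))))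
    (cong₂ _+_ (∑-const (fin (suc p)) 1) (∑-const Y₂ 2))))

  module _ (m+m′≡n+n : m + m′ ≡ n + n) where

    planeInRow pairsInRow : ℕ → ℕ
    planeInRow zero    = suc p
    planeInRow (suc _) = 1
    pairsInRow zero    = 0
    pairsInRow (suc _) = p + n

    size-Y₂ : size Y₂ ≡ n + n
    size-Y₂ = trans (*-comm n 2) (cong (n +_) (+-identityʳ n))

    y< : ∀ i → y i < suc (n + n)
    y< (inj₁ (inj₁ _))      = z<s
    y< (inj₁ (inj₂ v))      = s<s (subst (index Y₂ v <_) size-Y₂ (index<size Y₂ v))
    y< (inj₂ (at₁ (b , _))) = s<s (subst (index Yₘ (inj₁ b) <_) m+m′≡n+n (index<size Yₘ (inj₁ b)))
    y< (inj₂ (at₂ (b , a))) = s<s (index<size Yₙ (side (shift₂ b a) b))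
    y< (inj₂ (at₃ (b , _))) = s<s (subst (index Yₘ (inj₂ b) <_) m+m′≡n+n (index<size Yₘ (inj₂ b)))
    y< (inj₂ (at₄ (b , a))) = s<s (index<size Yₙ (side (shift₄ b a) b))

    ∑-planeInRow : ∀ k → k < suc (n + n) → ∑ c (λ u → 𝟙 (k ≟ y (inj₁ u))) ≡ planeInRow k
    ∑-planeInRow zero _ =
      trans (cong₂ _+_ (∑-1 (fin (suc p))) (∑-0 Y₂)) (+-identityʳ (suc p))
    ∑-planeInRow (suc k) k< =
      cong₂ _+_ (∑-0 (fin (suc p))) (∑-𝟙-index Y₂ (subst (k <_) (sym size-Y₂) (s<s⁻¹ k<)))

    -- A shift changes the half but keeps the offset b within it. So only pairs with b = b₀ can meet
    -- the given row, and among these the shift has to select the side `s`.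
    ∑-side : ∀ s b₀ (shift : Fin n → Fin n → Bool) →
      ∑ d₂ (λ (b , a) → 𝟙 (index Yₙ (side s b₀) ≟ index Yₙ (side (shift b a) b))) ≡
      ∑ (fin n) (λ a → 𝟙 (shift b₀ a Boolₚ.≟ s))
    ∑-side s b₀ shift = begin
      ∑ d₂ (λ (b , a) → 𝟙 (index Yₙ (side s b₀) ≟ index Yₙ (side (shift b a) b)))
        ≡⟨ ∑-cong d₂ (λ (b , a) → trans
             (𝟙-⇔ (mk⇔ (λ eq → let s≡ , b≡ = side-injective s (shift b a) (index-injective Yₙ eq) in sym b≡ , sym s≡)
                        (λ { (refl , s≡) → cong (λ s → index Yₙ (side s b₀)) (sym s≡) }))
                   (index Yₙ (side s b₀) ≟ index Yₙ (side (shift b a) b))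
                   ((b Finₚ.≟ b₀) ×-dec (shift b a Boolₚ.≟ s)))
             (𝟙-× (b Finₚ.≟ b₀) (shift b a Boolₚ.≟ s))) ⟩
      ∑ (fin n) (λ b → ∑ (fin n) λ a → 𝟙 (b Finₚ.≟ b₀) * 𝟙 (shift b a Boolₚ.≟ s))
        ≡⟨ ∑-cong (fin n) (λ b → ∑-*ˡ (fin n) (𝟙 (b Finₚ.≟ b₀)) (λ a → 𝟙 (shift b a Boolₚ.≟ s))) ⟩
      ∑ (fin n) (λ b → 𝟙 (b Finₚ.≟ b₀) * ∑ (fin n) λ a → 𝟙 (shift b a Boolₚ.≟ s))
        ≡⟨ ∑-𝟙 (fin n) (Finₚ._≟ b₀) (λ b → ∑ (fin n) λ a → 𝟙 (shift b a Boolₚ.≟ s)) refl id ⟩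
      ∑ (fin n) (λ a → 𝟙 (shift b₀ a Boolₚ.≟ s)) ∎

    𝟙-not : ∀ s t → 𝟙 (not t Boolₚ.≟ s) ≡ 𝟙 (t Boolₚ.≟ not s)
    𝟙-not true  true  = refl
    𝟙-not true  false = refl
    𝟙-not false true  = refl
    𝟙-not false false = refl

    -- Exactly one a is shifted in d₂ and exactly one a is not shifted in d₄.
    ∑-shifted : ∀ {k} → k < n + n →
      ∑ d₂ (λ w → 𝟙 (suc k ≟ y (inj₂ (at₂ w)))) + ∑ d₄ (λ w → 𝟙 (suc k ≟ y (inj₂ (at₄ w)))) ≡ n
    ∑-shifted k< with t , refl ← index-surjective Yₙ k< with s , b₀ , refl ← side-surjective t = begin
      _ ≡⟨ cong₂ _+_ (∑-side s b₀ shift₂) (∑-side s b₀ shift₄) ⟩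
      ∑ (fin n) (χ s (half b₀)) + ∑ (fin n) (λ a → 𝟙 (not (does (origin Finₚ.≟ a)) Boolₚ.≟ s))
        ≡⟨ cong (∑ (fin n) (χ s (half b₀)) +_) (∑-cong (fin n) λ a → 𝟙-not s (does (origin Finₚ.≟ a))) ⟩
      ∑ (fin n) (χ s (half b₀)) + ∑ (fin n) (χ (not s) origin)
        -- One family contributes 1 and the other n - 1; the two sides differ only in which family
        -- does which.
        ≡⟨ cong₂ _+_ (∑-χ s (half b₀)) (∑-χ (not s) origin) ⟩
      factor s n + factor (not s) n
        ≡⟨ ∑-factors s n 0<n ⟩
      n ∎

    ∑-unshifted : ∀ {k} → k < n + n →
      ∑ d₁ (λ w → 𝟙 (suc k ≟ y (inj₂ (at₁ w)))) + ∑ d₃ (λ w → 𝟙 (suc k ≟ y (inj₂ (at₃ w)))) ≡ p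
    ∑-unshifted {k} k< = begin
      ∑ d₁ (λ (b , _) → f (inj₁ b)) + ∑ d₃ (λ (b , _) → f (inj₂ b))
        ≡⟨ cong₂ _+_ (∑-cong (fin m) λ b → ∑-const (fin p) (f (inj₁ b)))
                     (∑-cong (fin m′) λ b → ∑-const (fin p) (f (inj₂ b))) ⟩
      ∑ Yₘ (λ t → p * f t)   ≡⟨ ∑-*ˡ Yₘ p f ⟩
      p * ∑ Yₘ f             ≡⟨ cong (p *_) (∑-𝟙-index Yₘ (subst (k <_) (sym m+m′≡n+n) k<)) ⟩
      p * 1                  ≡⟨ *-identityʳ p ⟩
      p ∎
      where
      f : El Yₘ → ℕ
      f t = 𝟙 (k ≟ index Yₘ t)

    ∑-pairsInRow : ∀ k → k < suc (n + n) → ∑ d (λ w → 𝟙 (k ≟ y (inj₂ w))) ≡ pairsInRow k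
    ∑-pairsInRow zero _ = cong₂ _+_ (∑-0 d₁) (cong₂ _+_ (∑-0 d₂) (cong₂ _+_ (∑-0 d₃) (∑-0 d₄)))
    ∑-pairsInRow (suc k) k< =
      trans (regroup (∑ d₁ _) (∑ d₂ _) (∑ d₃ _) (∑ d₄ _))
            (cong₂ _+_ (∑-unshifted (s<s⁻¹ k<)) (∑-shifted (s<s⁻¹ k<)))
      where
      regroup : ∀ t u v w → t + (u + (v + w)) ≡ (t + v) + (u + w)
      regroup = solve-∀

    κ-y : ∀ i j → κ false true i j ≡ 𝟙 (y i ≟ y j)
    κ-y i j = *-identityˡ _

    -- Every point contributes the size of its row: p + 1 for row 0, and 1 + 2(p + n) = p² + p + 1 =
    -- e₁ for every other row once p² = p + 2n.
    S-y : PairCounts.S I (x ∘ cell) (y ∘ cell) z (α false) (α true) (α false) ≡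
      (suc p * (suc p + 2 * 0) + n * 2 * (1 + 2 * (p + n))) + 2 * (size d * (1 + 2 * (p + n)))
    S-y = begin
      _ ≡⟨ S-free false true ⟩
      ∑₂ (λ i → ∑₂ (κ false true i))
        ≡⟨ ∑₂-cong (λ i → trans (∑₂-cong (κ-y i))
             (cong₂ (λ u v → u + 2 * v) (∑-planeInRow (y i) (y< i)) (∑-pairsInRow (y i) (y< i)))) ⟩
      ∑₂ (λ i → planeInRow (y i) + 2 * pairsInRow (y i))
        ≡⟨ cong₂ (λ u v → u + 2 * v)
             (cong₂ _+_ (∑-const (fin (suc p)) (suc p + 2 * 0)) (∑-const Y₂ (1 + 2 * (p + n))))
             (trans (∑-cong d pair-row) (∑-const d (1 + 2 * (p + n)))) ⟩
      _ ∎
      where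
      pair-row : ∀ w → planeInRow (y (inj₂ w)) + 2 * pairsInRow (y (inj₂ w)) ≡ 1 + 2 * (p + n)
      pair-row (at₁ _) = refl
      pair-row (at₂ _) = refl
      pair-row (at₃ _) = refl
      pair-row (at₄ _) = refl

    S-yz : PairCounts.S I (x ∘ cell) (y ∘ cell) z (α false) (α true) (α true) ≡
      (suc p * suc p + n * 2 * 1) + size d * 2
    S-yz = trans (S-agree false true) (cong (_+ size d * 2) (trans
      (∑-cong c λ u → trans (∑-cong c λ u′ → κ-y (inj₁ u) (inj₁ u′)) (∑-planeInRow (y (inj₁ u)) (y< (inj₁ u))))
      (cong₂ _+_ (∑-const (fin (suc p)) (suc p)) (∑-const Y₂ 1))))

    index-Y₂ : ∀ a ε → index Y₂ (a , ε) ≡ toℕ ε + (toℕ a + toℕ a)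
    index-Y₂ a ε = trans (index-⊗ (fin n) (fin 2) a ε)
      (trans (+-comm _ (toℕ ε)) (cong (λ k → toℕ ε + (toℕ a + k)) (+-identityʳ (toℕ a))))

    index-Yₙ : ∀ s b → index Yₙ (side s b) ≡ (if s then n else 0) + toℕ b
    index-Yₙ false b = index-inj₁ (fin n) (fin n) b
    index-Yₙ true  b = index-inj₂ (fin n) (fin n) b

    ⌊ε+2a/2⌋ : ∀ (ε : Fin 2) a → ⌊ toℕ ε + (a + a) /2⌋ ≡ a
    ⌊ε+2a/2⌋ zero       a = sym (n≡⌊n+n/2⌋ a)
    ⌊ε+2a/2⌋ (suc zero) a = sym (n≡⌈n+n/2⌉ a)

    2⌊b/2⌋≤b : ∀ b → ⌊ b /2⌋ + ⌊ b /2⌋ ≤ b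
    2⌊b/2⌋≤b b = ≤-trans (+-monoʳ-≤ ⌊ b /2⌋ (⌊n/2⌋≤⌈n/2⌉ b)) (≤-reflexive (⌊n/2⌋+⌈n/2⌉≡n b))

    -- The shift in d₂ moves a pair away from the points of the plane in its column.
    plane≢d₂ : 1 < n → ∀ a ε b → index Y₂ (a , ε) ≢ index Yₙ (side (shift₂ b a) b)
    plane≢d₂ 1<n a ε b eq = go (half b Finₚ.≟ a) (trans (sym (index-Y₂ a ε)) (trans eq (index-Yₙ (shift₂ b a) b)))
      where
      half≡ : toℕ (half b) ≡ ⌊ toℕ b /2⌋
      half≡ = Finₚ.toℕ-fromℕ< _
      go : (h? : Dec (half b ≡ a)) → toℕ ε + (toℕ a + toℕ a) ≡ (if does h? then n else 0) + toℕ b → _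
      -- Unshifted: halving both sides of the equation gives a = ⌊b/2⌋, the very condition for a
      -- shift.
      go (no h≢a) e = h≢a (Finₚ.toℕ-injective (begin
        toℕ (half b)                        ≡⟨ half≡ ⟩
        ⌊ toℕ b /2⌋                         ≡⟨ cong ⌊_/2⌋ e ⟨
        ⌊ toℕ ε + (toℕ a + toℕ a) /2⌋       ≡⟨ ⌊ε+2a/2⌋ ε (toℕ a) ⟩
        toℕ a                               ∎))
      -- Shifted: n + b exceeds ε + 2a, because ε ≤ 1 < n and 2a = 2⌊b/2⌋ ≤ b. For n = 1 the two
      -- sides can meet, with a = b = 0 and ε = 1.
      go (yes h≡a) e = <⇒≢ (+-mono-<-≤ (≤-<-trans (s≤s⁻¹ (Finₚ.toℕ<n ε)) 1<n) 2a≤b) e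
        where
        2a≤b : toℕ a + toℕ a ≤ toℕ b
        2a≤b = subst (λ k → k + k ≤ toℕ b) (trans (sym half≡) (cong toℕ h≡a)) (2⌊b/2⌋≤b (toℕ b))

    module _ (1<n : 1 < n) where

      -- A column meets at most one family besides the plane, and within one family the row
      -- determines the cell. Row 0 settles the plane against `d₁`, so the only delicate case is the
      -- plane against `d₂`.
      cell-injective : ∀ i j → column i ≡ column j → y i ≡ y j → i ≡ j
      cell-injective (inj₁ (inj₁ _))       (inj₁ (inj₁ _))       refl _ = refl
      cell-injective (inj₁ (inj₁ _))       (inj₂ (at₁ _))        refl ()
      cell-injective (inj₁ (inj₂ v))       (inj₁ (inj₂ v′))      refl e =
        cong (inj₁ ∘ inj₂) (index-injective Y₂ (suc-injective e))
      cell-injective (inj₁ (inj₂ (a , ε))) (inj₂ (at₂ (b , _)))  refl e =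
        contradiction (suc-injective e) (plane≢d₂ 1<n a ε b)
      cell-injective (inj₂ (at₁ _))        (inj₁ (inj₁ _))       refl ()
      cell-injective (inj₂ (at₁ (b , a)))  (inj₂ (at₁ (b′ , _))) refl e
        with refl ← index-injective Yₘ {inj₁ b} {inj₁ b′} (suc-injective e) = refl
      cell-injective (inj₂ (at₂ (b , _)))  (inj₁ (inj₂ (a , ε))) refl e =
        contradiction (sym (suc-injective e)) (plane≢d₂ 1<n a ε b)
      cell-injective (inj₂ (at₂ (b , a)))  (inj₂ (at₂ (b′ , _))) refl e
        with _ , refl ← side-injective (shift₂ b a) (shift₂ b′ a) (index-injective Yₙ (suc-injective e)) = refl
      cell-injective (inj₂ (at₃ (b , a)))  (inj₂ (at₃ (b′ , _))) refl e
        with refl ← index-injective Yₘ {inj₂ b} {inj₂ b′} (suc-injective e) = refl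
      cell-injective (inj₂ (at₄ (b , a)))  (inj₂ (at₄ (b′ , _))) refl e
        with _ , refl ← side-injective (shift₄ b a) (shift₄ b′ a) (index-injective Yₙ (suc-injective e)) = refl
      cell-injective (inj₁ (inj₁ _)) (inj₂ (at₃ _)) ()
      cell-injective (inj₁ (inj₁ _)) (inj₂ (at₄ _)) ()
      cell-injective (inj₁ (inj₂ _)) (inj₂ (at₃ _)) ()
      cell-injective (inj₁ (inj₂ _)) (inj₂ (at₄ _)) ()
      cell-injective (inj₂ (at₁ _))  (inj₂ (at₃ _)) ()
      cell-injective (inj₂ (at₁ _))  (inj₂ (at₄ _)) ()
      cell-injective (inj₂ (at₂ _))  (inj₂ (at₃ _)) ()
      cell-injective (inj₂ (at₂ _))  (inj₂ (at₄ _)) ()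
      cell-injective (inj₂ (at₃ _))  (inj₁ (inj₁ _)) ()
      cell-injective (inj₂ (at₃ _))  (inj₁ (inj₂ _)) ()
      cell-injective (inj₂ (at₄ _))  (inj₁ (inj₁ _)) ()
      cell-injective (inj₂ (at₄ _))  (inj₁ (inj₂ _)) ()

      κ-refl : ∀ i → κ true true i i ≡ 1
      κ-refl i = cong₂ _*_ (α-refl true (x i)) (α-refl true (y i))

      κ-zero : ∀ i j → j ≢ i → κ true true i j ≡ 0
      κ-zero i j j≢i with x i ≟ x j
      ... | no xᵢ≢xⱼ = cong (_* α true (y i) (y j)) (𝟙-no (x i ≟ x j) xᵢ≢xⱼ)
      ... | yes xᵢ≡xⱼ = trans
        (cong (α true (x i) (x j) *_) (𝟙-no (y i ≟ y j) λ yᵢ≡yⱼ →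
          j≢i (sym (cell-injective i j (index-injective X xᵢ≡xⱼ) yᵢ≡yⱼ))))
        (*-zeroʳ (α true (x i) (x j)))

      ∑-plane-xy : ∀ u → ∑ c (λ u′ → κ true true (inj₁ u) (inj₁ u′)) ≡ 1
      ∑-plane-xy u = trans
        (∑-single c {λ u′ → κ true true (inj₁ u) (inj₁ u′)} u
          λ u′ u′≢u → κ-zero (inj₁ u) (inj₁ u′) λ { refl → u′≢u refl })
        (κ-refl (inj₁ u))

      -- By `cell-injective` only points of one cell agree in x and y: one ordered pair for a cell
      -- of the plane, four for any other.
      S-xy : PairCounts.S I (x ∘ cell) (y ∘ cell) z (α true) (α true) (α false) ≡ size c + 2 * (size d * 2)
      S-xy = trans (S-free true true) (cong₂ (λ u v → u + 2 * v)
        (trans (∑-cong c plane) (∑-1 c)) (trans (∑-cong d pair) (∑-const d 2)))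
        where
        plane : ∀ u → ∑₂ (κ true true (inj₁ u)) ≡ 1
        plane u = cong₂ (λ v w → v + 2 * w) (∑-plane-xy u) (∑-zero d λ w → κ-zero (inj₁ u) (inj₂ w) λ ())
        pair : ∀ w → ∑₂ (κ true true (inj₂ w)) ≡ 2
        pair w = cong₂ (λ v w → v + 2 * w) (∑-zero c λ u → κ-zero (inj₂ w) (inj₁ u) λ ())
          (trans (∑-single d {λ w′ → κ true true (inj₂ w) (inj₂ w′)} w
                    λ w′ w′≢w → κ-zero (inj₂ w) (inj₂ w′) λ { refl → w′≢w refl })
                 (κ-refl (inj₂ w)))

      S-xyz : PairCounts.S I (x ∘ cell) (y ∘ cell) z (α true) (α true) (α true) ≡ size c + size d * 2
      S-xyz = trans (S-agree true true) (cong (_+ size d * 2) (trans (∑-cong c ∑-plane-xy) (∑-1 c)))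

      separated : ∀ i j → x (cell i) ≡ x (cell j) → y (cell i) ≡ y (cell j) → z i ≡ z j → i ≡ j
      separated (inj₁ u) (inj₁ u′) x≡ y≡ _
        with refl ← cell-injective (inj₁ u) (inj₁ u′) (index-injective X x≡) y≡ = refl
      separated (inj₂ v) (inj₂ v′) _ _ z≡ = cong inj₂ (index-injective (d ⊗ fin 2) (suc-injective z≡))
      separated (inj₁ _) (inj₂ _) _ _ ()
      separated (inj₂ _) (inj₁ _) _ _ ()

  S-all : PairCounts.S I (x ∘ cell) (y ∘ cell) z (α false) (α false) (α false) ≡
    (size c + 2 * size d) * (size c + 2 * size d)
  S-all = trans (S-free false false) (trans (cong₂ (λ u v → u + 2 * v) (total c) (total d))
    (trans (cong (size c * N +_) (sym (*-assoc 2 (size d) N))) (sym (*-distribʳ-+ N (size c) (2 * size d)))))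
    where
    N = size c + 2 * size d
    total : ∀ e → ∑ e (λ _ → ∑₂ (λ _ → 1)) ≡ size e * N
    total e = trans (∑-const e _) (cong (size e *_) (cong₂ (λ u v → u + 2 * v) (∑-1 c) (∑-1 d)))

  S-z : PairCounts.S I (x ∘ cell) (y ∘ cell) z (α false) (α false) (α true) ≡ size c * size c + size d * 2
  S-z = trans (S-agree false false) (cong (_+ size d * 2)
    (trans (∑-cong c λ _ → ∑-1 c) (∑-const c (size c))))

-- Arithmetic of the parameters

-- Each constant defined by truncated subtraction and division is evaluated from a single identity
-- that contains neither.
exact-quotient : ∀ k d a b .{{_ : NonZero d}} → a ≡ b + k * d → (a ∸ b) / d ≡ k
exact-quotient k d a b a≡ =
  trans (cong (_/ d) (trans (cong (_∸ b) a≡) (m+n∸m≡n b (k * d)))) (m*n/n≡m k d)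

-- These two relations settle every count except the one over columns, which is quadratic in m and
-- m′ separately.
module Identities (p n m m′ : ℕ) (p²≡ : p * p ≡ p + (n + n)) (m+m′≡ : m + m′ ≡ n + n) where

  D : ℕ
  D = m * p + (n * n + (m′ * p + n * n))

  -- The right side counts the pairs of twins by rows: 2n rows with p + n pairs each.
  D≡ : D ≡ (n + n) * (p + n)
  D≡ = trans (lhs m m′ n p) (trans (cong (λ k → k * p + (n + n) * n) m+m′≡) (sym (*-distribˡ-+ (n + n) p n)))
    where
    lhs : ∀ m m′ n p → m * p + (n * n + (m′ * p + n * n)) ≡ (m + m′) * p + (n + n) * n
    lhs = solve-∀

  -- The excess p + 2n + 2D is p⁴, and each count below is linear in p² once D is eliminated.
  excess : ℕ
  excess = p + n * 2 + D * 2

  by-p² : ∀ {l r} → l ≡ D * 2 + r + p * p → l ≡ excess + r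
  by-p² {l} {r} l≡ = trans l≡ (trans (cong (D * 2 + r +_) p²≡) (shuffle p n (D * 2) r))
    where
    shuffle : ∀ p n d r → d + r + (p + (n + n)) ≡ p + n * 2 + d + r
    shuffle = solve-∀

  E₁ E₂ E₃ : ℕ
  E₁ = suc p + (n + (p + n))
  E₂ = suc (n + n)
  E₃ = suc (D * 2)

  yz : (suc p * suc p + n * 2 * 1) + D * 2 ≡ excess + E₁ * (1 * 1)
  yz = by-p² (eq p n D)
    where
    eq : ∀ p n d → (suc p * suc p + n * 2 * 1) + d * 2 ≡ d * 2 + (suc p + (n + (p + n))) * (1 * 1) + p * p
    eq = solve-∀

  xz : (suc p * 1 + n * 2 * 2) + D * 2 ≡ excess + 1 * (E₂ * 1)
  xz = eq p n (D * 2)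
    where
    eq : ∀ p n d → (suc p * 1 + n * 2 * 2) + d ≡ p + n * 2 + d + 1 * (suc (n + n) * 1)
    eq = solve-∀

  xy : suc p + n * 2 + 2 * (D * 2) ≡ excess + 1 * (1 * E₃)
  xy = eq p n (D * 2)
    where
    eq : ∀ p n d → suc p + n * 2 + 2 * d ≡ p + n * 2 + d + 1 * (1 * suc d)
    eq = solve-∀

  xyz : suc p + n * 2 + D * 2 ≡ excess + 1 * (1 * 1)
  xyz = +-comm 1 excess

  z : (suc p + n * 2) * (suc p + n * 2) + D * 2 ≡ excess + E₁ * (E₂ * 1)
  z = by-p² (subst (λ d → (suc p + n * 2) * (suc p + n * 2) + d * 2 ≡ d * 2 + E₁ * (E₂ * 1) + p * p) (sym D≡) (eq p n))
    where
    eq : ∀ p n → (suc p + n * 2) * (suc p + n * 2) + (n + n) * (p + n) * 2 ≡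
      (n + n) * (p + n) * 2 + (suc p + (n + (p + n))) * (suc (n + n) * 1) + p * p
    eq = solve-∀

  y : (suc p * (suc p + 2 * 0) + n * 2 * (1 + 2 * (p + n))) + 2 * (D * (1 + 2 * (p + n))) ≡ excess + E₁ * (1 * E₃)
  y = by-p² (subst (λ d → (suc p * (suc p + 2 * 0) + n * 2 * (1 + 2 * (p + n))) + 2 * (d * (1 + 2 * (p + n))) ≡
                           d * 2 + E₁ * (1 * suc (d * 2)) + p * p) (sym D≡) (eq p n))
    where
    eq : ∀ p n →
      (suc p * (suc p + 2 * 0) + n * 2 * (1 + 2 * (p + n))) + 2 * ((n + n) * (p + n) * (1 + 2 * (p + n))) ≡
      (n + n) * (p + n) * 2 + (suc p + (n + (p + n))) * (1 * suc ((n + n) * (p + n) * 2)) + p * p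
    eq = solve-∀

  all : (suc p + n * 2 + 2 * D) * (suc p + n * 2 + 2 * D) ≡ excess + E₁ * (E₂ * E₃)
  all = by-p² (subst (λ d → (suc p + n * 2 + 2 * d) * (suc p + n * 2 + 2 * d) ≡
                             d * 2 + E₁ * (E₂ * suc (d * 2)) + p * p) (sym D≡) (eq p n))
    where
    eq : ∀ p n → (suc p + n * 2 + 2 * ((n + n) * (p + n))) * (suc p + n * 2 + 2 * ((n + n) * (p + n))) ≡
      (n + n) * (p + n) * 2 + (suc p + (n + (p + n))) * (suc (n + n) * suc ((n + n) * (p + n) * 2)) + p * p
    eq = solve-∀

  -- Hence e₃ = 1 + 2D, so that the twins use every nonzero z exactly once.
  p⁴≡ : p ^ 4 ≡ p ^ 2 + D * 2
  p⁴≡ = begin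
    p ^ 4                                ≡⟨ eq₁ p ⟩
    (p * p) * (p * p)                    ≡⟨ cong (λ k → k * k) p²≡ ⟩
    (p + (n + n)) * (p + (n + n))        ≡⟨ eq₂ p n ⟩
    p ^ 2 + (n + n) * (p + n) * 2        ≡⟨ cong (λ d → p ^ 2 + d * 2) D≡ ⟨
    p ^ 2 + D * 2                        ∎
    where
    eq₁ : ∀ p → p * (p * (p * (p * 1))) ≡ (p * p) * (p * p)
    eq₁ = solve-∀
    eq₂ : ∀ p n → (p + (n + n)) * (p + (n + n)) ≡ p * (p * 1) + (n + n) * (p + n) * 2
    eq₂ = solve-∀

  p²≡′ : p ^ 2 ≡ p + (n + n)
  p²≡′ = trans (cong (p *_) (*-identityʳ p)) p²≡

  e₁≡ : e₁ p ≡ E₁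
  e₁≡ = trans (cong (λ k → k + p + 1) p²≡′) (eq p n)
    where
    eq : ∀ p n → p + (n + n) + p + 1 ≡ suc p + (n + (p + n))
    eq = solve-∀

  e₂≡ : e₂ p ≡ E₂
  e₂≡ = trans (cong (_+ 1) (trans (cong (_∸ p) p²≡′) (m+n∸m≡n p (n + n)))) (+-comm (n + n) 1)

  e₃≡ : e₃ p ≡ E₃
  e₃≡ = trans (cong (_+ 1) (trans (cong (_∸ p ^ 2) p⁴≡) (m+n∸m≡n (p ^ 2) (D * 2)))) (+-comm (D * 2) 1)

  left₃≡ : (p ^ 2 + p) / 2 ≡ p + n
  left₃≡ = exact-quotient (p + n) 2 (p ^ 2 + p) 0 (trans (cong (_+ p) p²≡′) (eq p n))
    where
    eq : ∀ p n → p + (n + n) + p ≡ 0 + (p + n) * 2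
    eq = solve-∀

  left₄≡ : (p ^ 2 + 3 * p) / 2 ≡ p + (n + p)
  left₄≡ = exact-quotient (p + (n + p)) 2 (p ^ 2 + 3 * p) 0 (trans (cong (_+ 3 * p) p²≡′) (eq p n))
    where
    eq : ∀ p n → p + (n + n) + 3 * p ≡ 0 + (p + (n + p)) * 2
    eq = solve-∀

  -- The threshold in δ₂ never excludes a pair that the condition on b selects.
  below-threshold : ∀ a → 2 * a ≤ suc n → a ≤ (p ^ 2 ∸ p + 2) / 4
  below-threshold a 2a≤ = subst (_≤ (p ^ 2 ∸ p + 2) / 4) (m*n/n≡m a 4) (/-monoˡ-≤ 4 bound)
    where
    bound : a * 4 ≤ p ^ 2 ∸ p + 2
    bound = subst₂ _≤_ (eqˡ a) (trans (eqʳ n) (cong (_+ 2) (sym (trans (cong (_∸ p) p²≡′) (m+n∸m≡n p (n + n))))))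
      (*-monoʳ-≤ 2 2a≤)
      where
      eqˡ : ∀ a → 2 * (2 * a) ≡ a * 4
      eqˡ = solve-∀
      eqʳ : ∀ n → 2 * suc n ≡ n + n + 2
      eqʳ = solve-∀

-- What each parity has to supply. The offsets `c₀` and that of the fourth family are the numbers of
-- pairs in the families before, so that z continues without a gap. `columns` is the count in which
-- m and m′ do not enter through their sum alone.
record Parameters (p : ℕ) : Set where
  open BaseBlock p
  field
    1<n     : 1 < n
    p²≡     : p * p ≡ p + (n + n)
    m+m′≡   : m + m′ ≡ n + n
    c₀≡     : c₀ ≡ m * p + n * n
    z₄≡     : (p ^ 4 + 2 * p ^ 3 ∸ 3 * p ^ 2) / 4 ≡ m * p + (n * n + m′ * p)
    columns : ((1 + p * (1 + 2 * m)) + n * 2 * (2 + 2 * n)) +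
              2 * (m * p * (1 + 2 * m) + (n * n * (2 + 2 * n) + (m′ * p * (2 * m′) + n * n * (2 * n)))) ≡
              p + n * 2 + (m * p + (n * n + (m′ * p + n * n))) * 2 +
              1 * (suc (n + n) * suc ((m * p + (n * n + (m′ * p + n * n))) * 2))

-- In terms of `k` the parameters are polynomials, so every fact becomes a ring identity. Here 1 +
-- 2m = p² and 2m′ = (p - 1)².
module Odd (k p : ℕ) (p≡ : p ≡ 3 + 2 * k) where
  open BaseBlock p

  2∤p : does (2 ∣? p) ≡ false
  2∤p = dec-false (2 ∣? p) λ 2∣p →
    contradiction (∣⇒≤ (∣m+n∣m⇒∣n (subst (2 ∣_) (trans p≡ (eq k)) 2∣p) (m∣m*n (1 + k)))) 1+n≰n
    where
    eq : ∀ k → 3 + 2 * k ≡ 2 * (1 + k) + 1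
    eq = solve-∀

  n≡ : n ≡ (1 + k) * (3 + 2 * k)
  n≡ = exact-quotient _ 2 (p ^ 2) p (subst (λ p → p ^ 2 ≡ p + (1 + k) * (3 + 2 * k) * 2) (sym p≡) (eq k))
    where
    eq : ∀ k → let p = 3 + 2 * k in p * (p * 1) ≡ p + (1 + k) * (3 + 2 * k) * 2
    eq = solve-∀

  m≡ : m ≡ 2 * (1 + k) * (2 + k)
  m≡ = trans (cong (if_then (p ^ 2 ∸ 2 * p) / 2 else (p ^ 2 ∸ 1) / 2) 2∤p)
    (exact-quotient _ 2 (p ^ 2) 1 (subst (λ p → p ^ 2 ≡ 1 + 2 * (1 + k) * (2 + k) * 2) (sym p≡) (eq k)))
    where
    eq : ∀ k → let p = 3 + 2 * k in p * (p * 1) ≡ 1 + 2 * (1 + k) * (2 + k) * 2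
    eq = solve-∀

  m′≡ : m′ ≡ 2 * ((1 + k) * (1 + k))
  m′≡ = trans (cong (if_then p ^ 2 / 2 else (p ^ 2 ∸ 2 * p + 1) / 2) 2∤p)
    (exact-quotient _ 2 (p ^ 2 ∸ 2 * p + 1) 0 (trans (cong (_+ 1) (trans
      (cong (_∸ 2 * p) (subst (λ p → p ^ 2 ≡ 2 * p + (3 + 8 * k + 4 * (k * k))) (sym p≡) (eq₁ k)))
      (m+n∸m≡n (2 * p) (3 + 8 * k + 4 * (k * k))))) (eq₂ k)))
    where
    eq₁ : ∀ k → let p = 3 + 2 * k in p * (p * 1) ≡ 2 * p + (3 + 8 * k + 4 * (k * k))
    eq₁ = solve-∀
    eq₂ : ∀ k → 3 + 8 * k + 4 * (k * k) + 1 ≡ 0 + 2 * ((1 + k) * (1 + k)) * 2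
    eq₂ = solve-∀

  c₀≡ : c₀ ≡ m * p + n * n
  c₀≡ = trans (cong (if_then (p ^ 4 ∸ 3 * p ^ 2) / 4 else (p ^ 4 + p ^ 2 ∸ 2 * p) / 4) 2∤p)
    (exact-quotient _ 4 (p ^ 4 + p ^ 2) (2 * p) (eq p≡ n≡ m≡))
    where
    eq₀ : ∀ k → let p = 3 + 2 * k ; n = (1 + k) * (3 + 2 * k) ; m = 2 * (1 + k) * (2 + k) in
      p * (p * (p * (p * 1))) + p * (p * 1) ≡ 2 * p + (m * p + n * n) * 4
    eq₀ = solve-∀
    -- Variables replace the quotients `n` and `m`, so that the equations for them can be matched
    -- with `refl`.
    eq : ∀ {p n m} → p ≡ 3 + 2 * k → n ≡ (1 + k) * (3 + 2 * k) → m ≡ 2 * (1 + k) * (2 + k) →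
         p ^ 4 + p ^ 2 ≡ 2 * p + (m * p + n * n) * 4
    eq refl refl refl = eq₀ k

  parameters : Parameters p
  parameters = record
    { 1<n     = subst (1 <_) (sym n≡) (*-mono-≤ {1} {1 + k} {2} {3 + 2 * k} (s≤s z≤n) (s≤s (s≤s z≤n)))
    ; p²≡     = square p≡ n≡
    ; m+m′≡   = halves n≡ m≡ m′≡
    ; c₀≡     = c₀≡
    ; z₄≡     = exact-quotient _ 4 (p ^ 4 + 2 * p ^ 3) (3 * p ^ 2) (start p≡ n≡ m≡ m′≡)
    ; columns = columns p≡ n≡ m≡ m′≡
    }
    where
    square₀ : ∀ k → let p = 3 + 2 * k ; n = (1 + k) * (3 + 2 * k) in p * p ≡ p + (n + n)
    square₀ = solve-∀
    square : ∀ {p n} → p ≡ 3 + 2 * k → n ≡ (1 + k) * (3 + 2 * k) → p * p ≡ p + (n + n)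
    square refl refl = square₀ k

    halves₀ : ∀ k → let n = (1 + k) * (3 + 2 * k) ; m = 2 * (1 + k) * (2 + k) ; m′ = 2 * ((1 + k) * (1 + k)) in
      m + m′ ≡ n + n
    halves₀ = solve-∀
    halves : ∀ {n m m′} → n ≡ (1 + k) * (3 + 2 * k) → m ≡ 2 * (1 + k) * (2 + k) → m′ ≡ 2 * ((1 + k) * (1 + k)) →
      m + m′ ≡ n + n
    halves refl refl refl = halves₀ k

    start₀ : ∀ k → let p = 3 + 2 * k ; n = (1 + k) * (3 + 2 * k)
                       m = 2 * (1 + k) * (2 + k) ; m′ = 2 * ((1 + k) * (1 + k)) in
      p * (p * (p * (p * 1))) + 2 * (p * (p * (p * 1))) ≡ 3 * (p * (p * 1)) + (m * p + (n * n + m′ * p)) * 4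
    start₀ = solve-∀
    start : ∀ {p n m m′} → p ≡ 3 + 2 * k → n ≡ (1 + k) * (3 + 2 * k) →
            m ≡ 2 * (1 + k) * (2 + k) → m′ ≡ 2 * ((1 + k) * (1 + k)) →
      p ^ 4 + 2 * p ^ 3 ≡ 3 * p ^ 2 + (m * p + (n * n + m′ * p)) * 4
    start refl refl refl refl = start₀ k

    columns₀ : ∀ k → let p = 3 + 2 * k ; n = (1 + k) * (3 + 2 * k)
                         m = 2 * (1 + k) * (2 + k) ; m′ = 2 * ((1 + k) * (1 + k))
                         d = m * p + (n * n + (m′ * p + n * n)) in
      ((1 + p * (1 + 2 * m)) + n * 2 * (2 + 2 * n)) +
      2 * (m * p * (1 + 2 * m) + (n * n * (2 + 2 * n) + (m′ * p * (2 * m′) + n * n * (2 * n)))) ≡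
      p + n * 2 + d * 2 + 1 * (suc (n + n) * suc (d * 2))
    columns₀ = solve-∀
    columns : ∀ {p n m m′} → p ≡ 3 + 2 * k → n ≡ (1 + k) * (3 + 2 * k) →
              m ≡ 2 * (1 + k) * (2 + k) → m′ ≡ 2 * ((1 + k) * (1 + k)) →
      ((1 + p * (1 + 2 * m)) + n * 2 * (2 + 2 * n)) +
      2 * (m * p * (1 + 2 * m) + (n * n * (2 + 2 * n) + (m′ * p * (2 * m′) + n * n * (2 * n)))) ≡
      p + n * 2 + (m * p + (n * n + (m′ * p + n * n))) * 2 +
      1 * (suc (n + n) * suc ((m * p + (n * n + (m′ * p + n * n))) * 2))
    columns refl refl refl refl = columns₀ k

-- The column sizes change places: 1 + 2m = (p - 1)² and 2m′ = p², since now (p - 1)² is the odd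
-- one.
module Even (k p : ℕ) (p≡ : p ≡ 4 + 2 * k) where
  open BaseBlock p

  2∣p : does (2 ∣? p) ≡ true
  2∣p = dec-true (2 ∣? p) (subst (2 ∣_) (sym (trans p≡ (eq k))) (m∣m*n (2 + k)))
    where
    eq : ∀ k → 4 + 2 * k ≡ 2 * (2 + k)
    eq = solve-∀

  n≡ : n ≡ (2 + k) * (3 + 2 * k)
  n≡ = exact-quotient _ 2 (p ^ 2) p (subst (λ p → p ^ 2 ≡ p + (2 + k) * (3 + 2 * k) * 2) (sym p≡) (eq k))
    where
    eq : ∀ k → let p = 4 + 2 * k in p * (p * 1) ≡ p + (2 + k) * (3 + 2 * k) * 2
    eq = solve-∀

  m≡ : m ≡ 2 * (1 + k) * (2 + k)
  m≡ = trans (cong (if_then (p ^ 2 ∸ 2 * p) / 2 else (p ^ 2 ∸ 1) / 2) 2∣p)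
    (exact-quotient _ 2 (p ^ 2) (2 * p) (subst (λ p → p ^ 2 ≡ 2 * p + 2 * (1 + k) * (2 + k) * 2) (sym p≡) (eq k)))
    where
    eq : ∀ k → let p = 4 + 2 * k in p * (p * 1) ≡ 2 * p + 2 * (1 + k) * (2 + k) * 2
    eq = solve-∀

  m′≡ : m′ ≡ 2 * ((2 + k) * (2 + k))
  m′≡ = trans (cong (if_then p ^ 2 / 2 else (p ^ 2 ∸ 2 * p + 1) / 2) 2∣p)
    (exact-quotient _ 2 (p ^ 2) 0 (subst (λ p → p ^ 2 ≡ 0 + 2 * ((2 + k) * (2 + k)) * 2) (sym p≡) (eq k)))
    where
    eq : ∀ k → let p = 4 + 2 * k in p * (p * 1) ≡ 0 + 2 * ((2 + k) * (2 + k)) * 2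
    eq = solve-∀

  c₀≡ : c₀ ≡ m * p + n * n
  c₀≡ = trans (cong (if_then (p ^ 4 ∸ 3 * p ^ 2) / 4 else (p ^ 4 + p ^ 2 ∸ 2 * p) / 4) 2∣p)
    (exact-quotient _ 4 (p ^ 4) (3 * p ^ 2) (eq p≡ n≡ m≡))
    where
    eq₀ : ∀ k → let p = 4 + 2 * k ; n = (2 + k) * (3 + 2 * k) ; m = 2 * (1 + k) * (2 + k) in
      p * (p * (p * (p * 1))) ≡ 3 * (p * (p * 1)) + (m * p + n * n) * 4
    eq₀ = solve-∀
    eq : ∀ {p n m} → p ≡ 4 + 2 * k → n ≡ (2 + k) * (3 + 2 * k) → m ≡ 2 * (1 + k) * (2 + k) →
         p ^ 4 ≡ 3 * p ^ 2 + (m * p + n * n) * 4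
    eq refl refl refl = eq₀ k

  parameters : Parameters p
  parameters = record
    { 1<n     = subst (1 <_) (sym n≡) (*-mono-≤ {1} {2 + k} {2} {3 + 2 * k} (s≤s z≤n) (s≤s (s≤s z≤n)))
    ; p²≡     = square p≡ n≡
    ; m+m′≡   = halves n≡ m≡ m′≡
    ; c₀≡     = c₀≡
    ; z₄≡     = exact-quotient _ 4 (p ^ 4 + 2 * p ^ 3) (3 * p ^ 2) (start p≡ n≡ m≡ m′≡)
    ; columns = columns p≡ n≡ m≡ m′≡
    }
    where
    square₀ : ∀ k → let p = 4 + 2 * k ; n = (2 + k) * (3 + 2 * k) in p * p ≡ p + (n + n)
    square₀ = solve-∀
    square : ∀ {p n} → p ≡ 4 + 2 * k → n ≡ (2 + k) * (3 + 2 * k) → p * p ≡ p + (n + n)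
    square refl refl = square₀ k

    halves₀ : ∀ k → let n = (2 + k) * (3 + 2 * k) ; m = 2 * (1 + k) * (2 + k) ; m′ = 2 * ((2 + k) * (2 + k)) in
      m + m′ ≡ n + n
    halves₀ = solve-∀
    halves : ∀ {n m m′} → n ≡ (2 + k) * (3 + 2 * k) → m ≡ 2 * (1 + k) * (2 + k) → m′ ≡ 2 * ((2 + k) * (2 + k)) →
      m + m′ ≡ n + n
    halves refl refl refl = halves₀ k

    start₀ : ∀ k → let p = 4 + 2 * k ; n = (2 + k) * (3 + 2 * k)
                       m = 2 * (1 + k) * (2 + k) ; m′ = 2 * ((2 + k) * (2 + k)) in
      p * (p * (p * (p * 1))) + 2 * (p * (p * (p * 1))) ≡ 3 * (p * (p * 1)) + (m * p + (n * n + m′ * p)) * 4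
    start₀ = solve-∀
    start : ∀ {p n m m′} → p ≡ 4 + 2 * k → n ≡ (2 + k) * (3 + 2 * k) →
            m ≡ 2 * (1 + k) * (2 + k) → m′ ≡ 2 * ((2 + k) * (2 + k)) →
      p ^ 4 + 2 * p ^ 3 ≡ 3 * p ^ 2 + (m * p + (n * n + m′ * p)) * 4
    start refl refl refl refl = start₀ k

    columns₀ : ∀ k → let p = 4 + 2 * k ; n = (2 + k) * (3 + 2 * k)
                         m = 2 * (1 + k) * (2 + k) ; m′ = 2 * ((2 + k) * (2 + k))
                         d = m * p + (n * n + (m′ * p + n * n)) in
      ((1 + p * (1 + 2 * m)) + n * 2 * (2 + 2 * n)) +
      2 * (m * p * (1 + 2 * m) + (n * n * (2 + 2 * n) + (m′ * p * (2 * m′) + n * n * (2 * n)))) ≡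
      p + n * 2 + d * 2 + 1 * (suc (n + n) * suc (d * 2))
    columns₀ = solve-∀
    columns : ∀ {p n m m′} → p ≡ 4 + 2 * k → n ≡ (2 + k) * (3 + 2 * k) →
              m ≡ 2 * (1 + k) * (2 + k) → m′ ≡ 2 * ((2 + k) * (2 + k)) →
      ((1 + p * (1 + 2 * m)) + n * 2 * (2 + 2 * n)) +
      2 * (m * p * (1 + 2 * m) + (n * n * (2 + 2 * n) + (m′ * p * (2 * m′) + n * n * (2 * n)))) ≡
      p + n * 2 + (m * p + (n * n + (m′ * p + n * n))) * 2 +
      1 * (suc (n + n) * suc ((m * p + (n * n + (m′ * p + n * n))) * 2))
    columns refl refl refl refl = columns₀ k

-- Membership in the base block

even-or-odd : ∀ r → ∃ λ k → r ≡ 2 * k ⊎ r ≡ 1 + 2 * k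
even-or-odd zero = 0 , inj₁ refl
even-or-odd (suc zero) = 0 , inj₂ refl
even-or-odd (suc (suc r)) with even-or-odd r
... | k , inj₁ refl = suc k , inj₁ (sym (*-suc 2 k))
... | k , inj₂ refl = suc k , inj₂ (cong suc (sym (*-suc 2 k)))

parameters : ∀ {p} → 2 < p → Parameters p
parameters {suc (suc (suc r))} _ with even-or-odd r
... | k , inj₁ r≡ = Odd.parameters k (3 + r) (cong (3 +_) r≡)
... | k , inj₂ r≡ = Even.parameters k (3 + r) (cong (3 +_) r≡)
parameters {suc zero}       (s≤s ())
parameters {suc (suc zero)} (s≤s (s≤s ()))

from-[1,] : ∀ {k a} → 1 ≤ a → a ≤ k → ∃ λ (i : Fin k) → suc (toℕ i) ≡ a
from-[1,] {a = suc a} _ a<k = fromℕ< a<k , cong suc (Finₚ.toℕ-fromℕ< a<k)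

-- Common to p = 2 and p > 2: the plane is described by the same formulas in both cases, and the
-- rest is made of `Grid` families.
module Membership (p : ℕ) (d : Code) (x y : El ((fin (suc p) ⊕ fin (BaseBlock.n p) ⊗ fin 2) ⊕ d) → ℕ)
  (x₁ : ∀ a → x (inj₁ (inj₁ a)) ≡ toℕ a)
  (y₁ : ∀ a → y (inj₁ (inj₁ a)) ≡ 0)
  (x₂ : ∀ a ε → x (inj₁ (inj₂ (a , ε))) ≡ p + suc (toℕ a))
  (y₂ : ∀ a ε → y (inj₁ (inj₂ (a , ε))) ≡ suc (toℕ ε + (toℕ a + toℕ a)))
  where
  open BaseBlock p
  open TwinPairs (fin (suc p) ⊕ fin n ⊗ fin 2) d x y using (I; cell; z)

  pt : El I → ℕ × ℕ × ℕ
  pt i = x (cell i) , y (cell i) , z i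

  pt≡ : ∀ i {a b c} → x (cell i) ≡ a → y (cell i) ≡ b → z i ≡ c → pt i ≡ (a , b , c)
  pt≡ i refl refl refl = refl

  2a+1≡ : ∀ a → suc (a + a) ≡ 2 * suc a ∸ 1
  2a+1≡ a = trans (sym (+-suc a a)) (cong (λ k → a + suc k) (sym (+-identityʳ a)))

  2a+2≡ : ∀ a → suc (suc (a + a)) ≡ 2 * suc a
  2a+2≡ a = cong suc (2a+1≡ a)

  plane-sound : ∀ u → pt (inj₁ u) ∈ B′×0
  plane-sound (inj₁ a) = inj₁ (toℕ a , s≤s⁻¹ (Finₚ.toℕ<n a) , cong₂ _,_ (x₁ a) (y₁ a)) , refl
  plane-sound (inj₂ (a , zero)) = inj₂ (suc (toℕ a) , (s≤s z≤n , Finₚ.toℕ<n a) ,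
    inj₁ (cong₂ _,_ (x₂ a zero) (trans (y₂ a zero) (2a+1≡ (toℕ a))))) , refl
  plane-sound (inj₂ (a , suc zero)) = inj₂ (suc (toℕ a) , (s≤s z≤n , Finₚ.toℕ<n a) ,
    inj₂ (cong₂ _,_ (x₂ a (suc zero)) (trans (y₂ a (suc zero)) (2a+2≡ (toℕ a))))) , refl

  plane-complete : ∀ {t} → t ∈ B′×0 → ∃ λ i → pt i ≡ t
  plane-complete (inj₁ (a , a≤p , refl) , refl) =
    inj₁ (inj₁ (fromℕ< (s≤s a≤p))) ,
    pt≡ (inj₁ (inj₁ (fromℕ< (s≤s a≤p)))) (trans (x₁ _) (Finₚ.toℕ-fromℕ< (s≤s a≤p))) (y₁ _) refl
  plane-complete (inj₂ (_ , (1≤a , a≤n) , inj₁ refl) , refl) with a , refl ← from-[1,] 1≤a a≤n =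
    inj₁ (inj₂ (a , zero)) , pt≡ (inj₁ (inj₂ (a , zero))) (x₂ a zero) (trans (y₂ a zero) (2a+1≡ (toℕ a))) refl
  plane-complete (inj₂ (_ , (1≤a , a≤n) , inj₂ refl) , refl) with a , refl ← from-[1,] 1≤a a≤n =
    inj₁ (inj₂ (a , suc zero)) ,
    pt≡ (inj₁ (inj₂ (a , suc zero))) (x₂ a (suc zero)) (trans (y₂ a (suc zero)) (2a+2≡ (toℕ a))) refl

  z-lower : ∀ w → z (inj₂ (w , zero)) ≡ 2 * suc (index d w) ∸ 1
  z-lower w = trans (cong suc (trans (index-⊗ d (fin 2) w zero) (lemma (index d w)))) (2a+1≡ (index d w))
    where
    lemma : ∀ q → 2 * q + 0 ≡ q + q
    lemma = solve-∀

  z-upper : ∀ w → z (inj₂ (w , suc zero)) ≡ 2 * suc (index d w)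
  z-upper w = trans (cong suc (trans (index-⊗ d (fin 2) w (suc zero)) (lemma (index d w)))) (2a+2≡ (index d w))
    where
    lemma : ∀ q → 2 * q + 1 ≡ suc (q + q)
    lemma = solve-∀

  -- Families are numbered from 1 and elements of `Fin` from 0, hence the successors. The third
  -- equation fixes the z of the upper twin; the lower one is one less.
  Parametrises : ∀ k l (X Y C : ℕ → ℕ → ℕ) → (Fin l × Fin k → El d) → Set
  Parametrises k l X Y C f = ∀ b a →
    x (inj₂ (f (b , a))) ≡ X (suc (toℕ a)) (suc (toℕ b)) ×
    y (inj₂ (f (b , a))) ≡ Y (suc (toℕ a)) (suc (toℕ b)) ×
    2 * suc (index d (f (b , a))) ≡ C (suc (toℕ a)) (suc (toℕ b))

  module _ {k l X Y C} (f : Fin l × Fin k → El d) (spec : Parametrises k l X Y C f) where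

    lower : ∀ b a → pt (inj₂ (f (b , a) , zero)) ≡
      (X (suc (toℕ a)) (suc (toℕ b)) , Y (suc (toℕ a)) (suc (toℕ b)) , C (suc (toℕ a)) (suc (toℕ b)) ∸ 1)
    lower b a = let x≡ , y≡ , c≡ = spec b a in
      pt≡ (inj₂ (f (b , a) , zero)) x≡ y≡ (trans (z-lower (f (b , a))) (cong (_∸ 1) c≡))

    upper : ∀ b a → pt (inj₂ (f (b , a) , suc zero)) ≡
      (X (suc (toℕ a)) (suc (toℕ b)) , Y (suc (toℕ a)) (suc (toℕ b)) , C (suc (toℕ a)) (suc (toℕ b)))
    upper b a = let x≡ , y≡ , c≡ = spec b a in
      pt≡ (inj₂ (f (b , a) , suc zero)) x≡ y≡ (trans (z-upper (f (b , a))) c≡)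

    grid-sound : ∀ b a ε → pt (inj₂ (f (b , a) , ε)) ∈ Grid k l X Y C
    grid-sound b a ε =
      suc (toℕ a) , suc (toℕ b) , (s≤s z≤n , Finₚ.toℕ<n a) , (s≤s z≤n , Finₚ.toℕ<n b) , twin ε
      where
      twin : ∀ ε → pt (inj₂ (f (b , a) , ε)) ∈ Twins (X (suc (toℕ a)) (suc (toℕ b))) (Y (suc (toℕ a)) (suc (toℕ b)))
                                                     (C (suc (toℕ a)) (suc (toℕ b)))
      twin zero       = inj₁ (lower b a)
      twin (suc zero) = inj₂ (upper b a)

    grid-complete : ∀ {t} → t ∈ Grid k l X Y C → ∃ λ i → pt i ≡ t
    grid-complete (_ , _ , (1≤a , a≤k) , (1≤b , b≤l) , twin)
      with a , refl ← from-[1,] 1≤a a≤k with b , refl ← from-[1,] 1≤b b≤l with twin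
    ... | inj₁ refl = inj₂ (f (b , a) , zero) , lower b a
    ... | inj₂ refl = inj₂ (f (b , a) , suc zero) , upper b a

module Large (p : ℕ) (2<p : 2 < p) where
  open BaseBlock p
  open Parameters (parameters 2<p)
  open Columns p n m m′ (<-trans z<s 1<n)
  open TwinPairs c d x y using (I; cell; z)
  module Total = Identities p n m m′ p²≡ m+m′≡

  x-at₂ : ∀ a → index X (at₂ a) ≡ p + suc (toℕ a)
  x-at₂ a = trans (index-at₂ (fin (suc p)) (fin n) (fin p) (fin n) a) (sym (+-suc p (toℕ a)))

  x-at₃ : ∀ a → index X (at₃ a) ≡ (p ^ 2 + p) / 2 + suc (toℕ a)
  x-at₃ a = begin
    index X (at₃ a)                    ≡⟨ index-at₃ (fin (suc p)) (fin n) (fin p) (fin n) a ⟩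
    suc p + (n + toℕ a)                ≡⟨ eq p n (toℕ a) ⟩
    p + n + suc (toℕ a)                ≡⟨ cong (_+ suc (toℕ a)) Total.left₃≡ ⟨
    (p ^ 2 + p) / 2 + suc (toℕ a)      ∎
    where
    eq : ∀ p n a → suc p + (n + a) ≡ p + n + suc a
    eq = solve-∀

  x-at₄ : ∀ a → index X (at₄ a) ≡ (p ^ 2 + 3 * p) / 2 + suc (toℕ a)
  x-at₄ a = begin
    index X (at₄ a)                    ≡⟨ index-at₄ (fin (suc p)) (fin n) (fin p) (fin n) a ⟩
    suc p + (n + (p + toℕ a))          ≡⟨ eq p n (toℕ a) ⟩
    p + (n + p) + suc (toℕ a)          ≡⟨ cong (_+ suc (toℕ a)) Total.left₄≡ ⟨
    (p ^ 2 + 3 * p) / 2 + suc (toℕ a)  ∎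
    where
    eq : ∀ p n a → suc p + (n + (p + a)) ≡ p + (n + p) + suc a
    eq = solve-∀

  open Membership p d x y (λ a → index-at₁ (fin (suc p)) (fin n) (fin p) (fin n) a) (λ _ → refl) (λ a _ → x-at₂ a)
    (λ a ε → cong suc (index-Y₂ m+m′≡ a ε))

  params₁ : Parametrises p m (λ a b → a) (λ a b → b) (λ a b → 2 * (a + (b ∸ 1) * p)) at₁
  params₁ b a =
    index-at₁ (fin (suc p)) (fin n) (fin p) (fin n) (suc a) ,
    cong suc (index-inj₁ (fin m) (fin m′) b) ,
    cong (2 *_) (trans (cong suc (trans (index-at₁ d₁ d₂ d₃ d₄ (b , a)) (index-⊗ (fin m) (fin p) b a)))
                  (eq p (toℕ a) (toℕ b)))
    where
    eq : ∀ p a b → suc (p * b + a) ≡ suc a + b * p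
    eq = solve-∀

  parity-of : ∀ b → b ≡ ⌊ b /2⌋ + ⌊ b /2⌋ ⊎ b ≡ suc (⌊ b /2⌋ + ⌊ b /2⌋)
  parity-of zero          = inj₁ refl
  parity-of (suc zero)    = inj₂ refl
  parity-of (suc (suc b)) with parity-of b
  ... | inj₁ b≡ = inj₁ (cong suc (trans (cong suc b≡) (sym (+-suc ⌊ b /2⌋ ⌊ b /2⌋))))
  ... | inj₂ b≡ = inj₂ (cong suc (trans (cong suc b≡) (cong suc (sym (+-suc ⌊ b /2⌋ ⌊ b /2⌋)))))

  Shifted : ℕ → ℕ → Set
  Shifted a b = a ≤ (p ^ 2 ∸ p + 2) / 4 × (b ≡ 2 * a ∸ 1 ⊎ b ≡ 2 * a)

  shifted? : ∀ a b → Dec (Shifted a b)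
  shifted? a b = a ≤? (p ^ 2 ∸ p + 2) / 4 ×-dec (b ≟ 2 * a ∸ 1 ⊎-dec b ≟ 2 * a)

  shifted⇔half : ∀ b a → Shifted (suc (toℕ a)) (suc (toℕ b)) ⇔ half b ≡ a
  shifted⇔half b a = mk⇔
    (λ { (_ , inj₁ e) → half≡ zero (suc-injective (trans e (sym (2a+1≡ (toℕ a)))))
       ; (_ , inj₂ e) → half≡ (suc zero) (suc-injective (trans e (sym (2a+2≡ (toℕ a))))) })
    from-half
    where
    half≡ : ∀ ε → toℕ b ≡ toℕ {2} ε + (toℕ a + toℕ a) → half b ≡ a
    half≡ ε b≡ = Finₚ.toℕ-injective
      (trans (Finₚ.toℕ-fromℕ< _) (trans (cong ⌊_/2⌋ b≡) (⌊ε+2a/2⌋ m+m′≡ ε (toℕ a))))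
    from-half : half b ≡ a → Shifted (suc (toℕ a)) (suc (toℕ b))
    from-half refl =
      -- From 2⌊b/2⌋ ≤ b ≤ n - 1 it follows that 2(⌊b/2⌋ + 1) ≤ n + 1.
      Total.below-threshold (suc (toℕ (half b)))
        (subst (_≤ suc n) (2a+2≡ (toℕ (half b)))
          (s≤s (≤-<-trans (subst (λ h → h + h ≤ toℕ b) (sym half-toℕ) (2⌊b/2⌋≤b m+m′≡ (toℕ b))) (Finₚ.toℕ<n b)))) ,
      subst (λ h → suc (toℕ b) ≡ 2 * suc h ∸ 1 ⊎ suc (toℕ b) ≡ 2 * suc h) (sym half-toℕ) (by-parity (parity-of (toℕ b)))
      where
      half-toℕ : toℕ (half b) ≡ ⌊ toℕ b /2⌋
      half-toℕ = Finₚ.toℕ-fromℕ< _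
      by-parity : ∀ {b h} → b ≡ h + h ⊎ b ≡ suc (h + h) → suc b ≡ 2 * suc h ∸ 1 ⊎ suc b ≡ 2 * suc h
      by-parity {h = h} (inj₁ b≡) = inj₁ (trans (cong suc b≡) (2a+1≡ h))
      by-parity {h = h} (inj₂ b≡) = inj₂ (trans (cong suc b≡) (2a+2≡ h))

  params₂ : Parametrises n n (λ a b → p + a) (λ a b → b + δ₂ a b) (λ a b → 2 * p * m + 2 * (a + (b ∸ 1) * n)) at₂
  params₂ b a =
    x-at₂ a ,
    cong suc (trans (index-Yₙ m+m′≡ (shift₂ b a) b) (trans (+-comm _ (toℕ b))
      (cong (λ s → toℕ b + (if s then n else 0)) (does-⇔ (mk⇔ (Equivalence.from (shifted⇔half b a)) (Equivalence.to (shifted⇔half b a)))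
        (half b Finₚ.≟ a) (shifted? (suc (toℕ a)) (suc (toℕ b))))))) ,
    trans (cong (λ q → 2 * suc q)
            (trans (index-at₂ d₁ d₂ d₃ d₄ (b , a)) (cong (m * p +_) (index-⊗ (fin n) (fin n) b a))))
          (eq p n m (toℕ a) (toℕ b))
    where
    eq : ∀ p n m a b → 2 * suc (m * p + (n * b + a)) ≡ 2 * p * m + 2 * (suc a + b * n)
    eq = solve-∀

  params₃ : Parametrises p m′ (λ a b → (p ^ 2 + p) / 2 + a) (λ a b → m + b)
    (λ a b → 2 * c₀ + 2 * (a + (b ∸ 1) * p)) at₃
  params₃ b a =
    x-at₃ a ,
    trans (cong suc (index-inj₂ (fin m) (fin m′) b)) (sym (+-suc m (toℕ b))) ,
    (begin
      2 * suc (index d (at₃ (b , a)))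
        ≡⟨ cong (λ q → 2 * suc q) (trans (index-at₃ d₁ d₂ d₃ d₄ (b , a))
             (cong (λ k → m * p + (n * n + k)) (index-⊗ (fin m′) (fin p) b a))) ⟩
      2 * suc (m * p + (n * n + (p * toℕ b + toℕ a)))
        ≡⟨ eq p n m (toℕ a) (toℕ b) ⟩
      2 * (m * p + n * n) + 2 * (suc (toℕ a) + toℕ b * p)
        ≡⟨ cong (λ k → 2 * k + 2 * (suc (toℕ a) + toℕ b * p)) c₀≡ ⟨
      2 * c₀ + 2 * (suc (toℕ a) + toℕ b * p) ∎)
    where
    eq : ∀ p n m a b → 2 * suc (m * p + (n * n + (p * b + a))) ≡ 2 * (m * p + n * n) + 2 * (suc a + b * p)
    eq = solve-∀

  params₄ : Parametrises n n (λ a b → (p ^ 2 + 3 * p) / 2 + a) (λ a b → b + δ₄ a b)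
    (λ a b → 2 * ((p ^ 4 + 2 * p ^ 3 ∸ 3 * p ^ 2) / 4) + 2 * (a + (b ∸ 1) * n)) at₄
  params₄ b a =
    x-at₄ a ,
    cong suc (trans (index-Yₙ m+m′≡ (shift₄ b a) b) (trans (+-comm _ (toℕ b)) (cong (toℕ b +_) shift≡δ))) ,
    (begin
      2 * suc (index d (at₄ (b , a)))
        ≡⟨ cong (λ q → 2 * suc q) (trans (index-at₄ d₁ d₂ d₃ d₄ (b , a))
             (cong (λ k → m * p + (n * n + (m′ * p + k))) (index-⊗ (fin n) (fin n) b a))) ⟩
      2 * suc (m * p + (n * n + (m′ * p + (n * toℕ b + toℕ a))))
        ≡⟨ eq p n m m′ (toℕ a) (toℕ b) ⟩
      2 * (m * p + (n * n + m′ * p)) + 2 * (suc (toℕ a) + toℕ b * n)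
        ≡⟨ cong (λ k → 2 * k + 2 * (suc (toℕ a) + toℕ b * n)) z₄≡ ⟨
      2 * ((p ^ 4 + 2 * p ^ 3 ∸ 3 * p ^ 2) / 4) + 2 * (suc (toℕ a) + toℕ b * n) ∎)
    where
    eq : ∀ p n m m′ a b → 2 * suc (m * p + (n * n + (m′ * p + (n * b + a)))) ≡
      2 * (m * p + (n * n + m′ * p)) + 2 * (suc a + b * n)
    eq = solve-∀
    origin⇔ : (origin ≡ a) ⇔ (suc (toℕ a) ≡ 1)
    origin⇔ = mk⇔ (λ { refl → cong suc (Finₚ.toℕ-fromℕ< _) })
                  (λ a≡ → Finₚ.toℕ-injective (trans (Finₚ.toℕ-fromℕ< _) (sym (suc-injective a≡))))
    if-not : ∀ b → (if not b then n else 0) ≡ (if b then 0 else n)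
    if-not true  = refl
    if-not false = refl
    shift≡δ : (if shift₄ b a then n else 0) ≡ δ₄ (suc (toℕ a)) (suc (toℕ b))
    shift≡δ = trans (if-not (does (origin Finₚ.≟ a)))
      (cong (if_then 0 else n) (does-⇔ origin⇔ (origin Finₚ.≟ a) (suc (toℕ a) ≟ 1)))

  pt-sound : ∀ i → pt i ∈ Bℕ
  pt-sound (inj₁ u)                 = inj₁ (plane-sound u)
  pt-sound (inj₂ (at₁ (b , a) , ε)) = inj₂ (inj₂ (2<p , inj₁ (grid-sound at₁ params₁ b a ε)))
  pt-sound (inj₂ (at₂ (b , a) , ε)) = inj₂ (inj₂ (2<p , inj₂ (inj₁ (grid-sound at₂ params₂ b a ε))))
  pt-sound (inj₂ (at₃ (b , a) , ε)) = inj₂ (inj₂ (2<p , inj₂ (inj₂ (inj₁ (grid-sound at₃ params₃ b a ε)))))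
  pt-sound (inj₂ (at₄ (b , a) , ε)) = inj₂ (inj₂ (2<p , inj₂ (inj₂ (inj₂ (grid-sound at₄ params₄ b a ε)))))

  pt-complete : ∀ {t} → t ∈ Bℕ → ∃ λ i → pt i ≡ t
  pt-complete (inj₁ t∈plane)                            = plane-complete t∈plane
  pt-complete (inj₂ (inj₁ (p≡2 , _)))                   = contradiction (sym p≡2) (<⇒≢ 2<p)
  pt-complete (inj₂ (inj₂ (_ , inj₁ t∈)))               = grid-complete at₁ params₁ t∈
  pt-complete (inj₂ (inj₂ (_ , inj₂ (inj₁ t∈))))        = grid-complete at₂ params₂ t∈
  pt-complete (inj₂ (inj₂ (_ , inj₂ (inj₂ (inj₁ t∈))))) = grid-complete at₃ params₃ t∈
  pt-complete (inj₂ (inj₂ (_ , inj₂ (inj₂ (inj₂ t∈))))) = grid-complete at₄ params₄ t∈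

  parametrisation : Parametrisation Bℕ Total.E₁ Total.E₂ Total.E₃
  parametrisation = record
    { I         = I
    ; x         = x ∘ cell
    ; y         = y ∘ cell
    ; z         = z
    ; x<        = λ i → index<size X (column (cell i))
    ; y<        = λ i → y< m+m′≡ (cell i)
    ; z<        = z<
    ; sound     = pt-sound
    ; complete  = pt-complete
    ; separated = separated m+m′≡ 1<n
    ; excess    = Total.excess
    ; agreeing  = agreeing
    }
    where
    z< : ∀ i → z i < Total.E₃
    z< (inj₁ _) = z<s
    z< (inj₂ v) = s<s (index<size (d ⊗ fin 2) v)
    agreeing : ∀ b₁ b₂ b₃ → PairCounts.S I (x ∘ cell) (y ∘ cell) z (α b₁) (α b₂) (α b₃) ≡
      Total.excess + free b₁ Total.E₁ * (free b₂ Total.E₂ * free b₃ Total.E₃)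
    agreeing true  true  true  = trans (S-xyz m+m′≡ 1<n) Total.xyz
    agreeing true  true  false = trans (S-xy m+m′≡ 1<n) Total.xy
    agreeing true  false true  = trans S-xz Total.xz
    agreeing true  false false = trans S-x columns
    agreeing false true  true  = trans (S-yz m+m′≡) Total.yz
    agreeing false true  false = trans (S-y m+m′≡) Total.y
    agreeing false false true  = trans S-z Total.z
    agreeing false false false = trans S-all Total.all

-- For p = 2, where n = 1, the general formulas would put a pair of twins over a point of the plane,
-- so the block is built differently. It has 17 points, and its eight counts are obtained by
-- evaluation.
module Two where
  open BaseBlock 2

  d : Code
  d = fin 2 ⊗ fin 3

  x y : El ((fin 3 ⊕ fin 1 ⊗ fin 2) ⊕ d) → ℕ
  x (inj₁ (inj₁ a))       = toℕ a
  x (inj₁ (inj₂ (a , _))) = 2 + suc (toℕ a)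
  x (inj₂ (_ , a))        = 3 + suc (toℕ a)
  y (inj₁ (inj₁ _))       = 0
  y (inj₁ (inj₂ (a , ε))) = suc (toℕ ε + (toℕ a + toℕ a))
  y (inj₂ (b , _))        = suc (toℕ b)

  open TwinPairs (fin 3 ⊕ fin 1 ⊗ fin 2) d x y using (I; cell; z)
  open Membership 2 d x y (λ _ → refl) (λ _ → refl) (λ _ _ → refl) (λ _ _ → refl)

  params : Parametrises 3 2 (λ a b → 3 + a) (λ a b → b) (λ a b → 2 * (a + 3 * (b ∸ 1))) id
  params b a = refl , refl ,
    cong (λ q → 2 * suc q) (trans (index-⊗ (fin 2) (fin 3) b a) (+-comm (3 * toℕ b) (toℕ a)))

  parametrisation : Parametrisation Bℕ 7 3 13
  parametrisation = record
    { I         = I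
    ; x         = x ∘ cell
    ; y         = y ∘ cell
    ; z         = z
    ; x<        = x<
    ; y<        = y<
    ; z<        = z<
    ; sound     = λ { (inj₁ u)             → inj₁ (plane-sound u)
                    ; (inj₂ ((b , a) , ε)) → inj₂ (inj₁ (refl , grid-sound id params b a ε)) }
    ; complete  = λ { (inj₁ t∈)              → plane-complete t∈
                    ; (inj₂ (inj₁ (_ , t∈))) → grid-complete id params t∈
                    ; (inj₂ (inj₂ (2<2 , _))) → contradiction 2<2 (<-irrefl refl) }
    ; separated = separated
    ; excess    = 16
    ; agreeing  = agreeing
    }
    where
    x< : ∀ i → x (cell i) < 7
    x< (inj₁ (inj₁ a))       = <-≤-trans (Finₚ.toℕ<n a) (m≤m+n 3 4)
    x< (inj₁ (inj₂ (a , _))) = <-≤-trans (+-monoʳ-< 3 (Finₚ.toℕ<n a)) (m≤m+n 4 3)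
    x< (inj₂ ((_ , a) , _))  = +-monoʳ-< 4 (Finₚ.toℕ<n a)
    y< : ∀ i → y (cell i) < 3
    y< (inj₁ (inj₁ _))          = z<s
    y< (inj₁ (inj₂ (zero , ε))) = s<s (subst (_< 2) (sym (+-identityʳ (toℕ ε))) (Finₚ.toℕ<n ε))
    y< (inj₂ ((b , _) , _))     = s<s (Finₚ.toℕ<n b)
    z< : ∀ i → z i < 13
    z< (inj₁ _) = z<s
    z< (inj₂ v) = s<s (index<size (d ⊗ fin 2) v)
    separated : ∀ i j → x (cell i) ≡ x (cell j) → y (cell i) ≡ y (cell j) → z i ≡ z j → i ≡ j
    separated (inj₁ (inj₁ a)) (inj₁ (inj₁ a′)) x≡ _ _ = cong (inj₁ ∘ inj₁) (Finₚ.toℕ-injective x≡)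
    separated (inj₁ (inj₁ _)) (inj₁ (inj₂ _)) _ () _
    separated (inj₁ (inj₂ _)) (inj₁ (inj₁ _)) _ () _
    separated (inj₁ (inj₂ (zero , ε))) (inj₁ (inj₂ (zero , ε′))) _ y≡ _ =
      cong (λ ε → inj₁ (inj₂ (zero , ε)))
        (Finₚ.toℕ-injective (+-cancelʳ-≡ 0 (toℕ ε) (toℕ ε′) (suc-injective y≡)))
    separated (inj₁ _) (inj₂ _) _ _ ()
    separated (inj₂ _) (inj₁ _) _ _ ()
    separated (inj₂ v) (inj₂ v′) _ _ z≡ = cong inj₂ (index-injective (d ⊗ fin 2) (suc-injective z≡))
    agreeing : ∀ b₁ b₂ b₃ → PairCounts.S I (x ∘ cell) (y ∘ cell) z (α b₁) (α b₂) (α b₃) ≡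
      16 + free b₁ 7 * (free b₂ 3 * free b₃ 13)
    agreeing true  true  true  = refl
    agreeing true  true  false = refl
    agreeing true  false true  = refl
    agreeing true  false false = refl
    agreeing false true  true  = refl
    agreeing false true  false = refl
    agreeing false false true  = refl
    agreeing false false false = refl

-- Size of the base block, number of points, and the design

record GoodBlock (p E₁ E₂ E₃ : ℕ) : Set where
  field
    parametrisation : Parametrisation (BaseBlock.Bℕ p) E₁ E₂ E₃
    blockSize       : size (Parametrisation.I parametrisation) ≡ p ^ 4 + 1
    pointCount      : E₁ * (E₂ * E₃) ≡ p ^ 8 + p ^ 4 + 1
    1<E₁            : 1 < E₁
    1<E₂            : 1 < E₂
    1<E₃            : 1 < E₃

goodBlock-large : ∀ {p} → 2 < p → GoodBlock p (e₁ p) (e₂ p) (e₃ p)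
goodBlock-large {p} 2<p = transport (sym e₁≡) (sym e₂≡) (sym e₃≡) record
  { parametrisation = parametrisation
  ; blockSize       = trans (cong suc (sym p⁴≡excess)) (+-comm 1 (p ^ 4))
  ; pointCount      = points
  ; 1<E₁            = s<s (≤-trans (<-trans z<s 2<p) (m≤m+n p _))
  ; 1<E₂            = s<s (≤-trans (<-trans z<s 1<n) (m≤m+n n n))
  ; 1<E₃            = s<s (≤-trans 0<D (m≤m*n D 2))
  }
  where
  open BaseBlock p using (n)
  open Large p 2<p using (parametrisation; module Total)
  open Parameters (parameters 2<p) using (1<n)
  open Total

  -- The counts are made with subtraction-free forms of the sizes; the finished record is carried
  -- over to `e₁ p`, `e₂ p` and `e₃ p` in one move.
  transport : ∀ {E₁ E₂ E₃ E₁′ E₂′ E₃′} → E₁ ≡ E₁′ → E₂ ≡ E₂′ → E₃ ≡ E₃′ →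
              GoodBlock p E₁ E₂ E₃ → GoodBlock p E₁′ E₂′ E₃′
  transport refl refl refl good = good

  p⁴≡excess : p ^ 4 ≡ excess
  p⁴≡excess = trans p⁴≡ (cong (_+ D * 2) (trans p²≡′ (eq p n)))
    where
    eq : ∀ p n → p + (n + n) ≡ p + n * 2
    eq = solve-∀

  0<D : 0 < D
  0<D = subst (0 <_) (sym D≡) (*-mono-≤ {1} {n + n} {1} {p + n}
    (≤-trans (<-trans z<s 1<n) (m≤m+n n n)) (≤-trans (<-trans z<s 2<p) (m≤m+n p n)))

  points : E₁ * (E₂ * E₃) ≡ p ^ 8 + p ^ 4 + 1
  -- The count of all ordered pairs of points of the block reads k² = p⁴ + v with k = p⁴ + 1, which
  -- determines v.
  points = +-cancelˡ-≡ (p ^ 4) _ _ (begin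
    p ^ 4 + E₁ * (E₂ * E₃)                                     ≡⟨ cong (_+ E₁ * (E₂ * E₃)) p⁴≡excess ⟩
    excess + E₁ * (E₂ * E₃)                                    ≡⟨ all ⟨
    (suc p + n * 2 + 2 * D) * (suc p + n * 2 + 2 * D)          ≡⟨ cong (λ k → k * k) (cong (suc p + n * 2 +_) (*-comm 2 D)) ⟩
    suc excess * suc excess                                    ≡⟨ cong (λ q → suc q * suc q) p⁴≡excess ⟨
    suc (p ^ 4) * suc (p ^ 4)                                  ≡⟨ eq (p ^ 4) ⟩
    p ^ 4 + (p ^ 4 * p ^ 4 + p ^ 4 + 1)                        ≡⟨ cong (λ k → p ^ 4 + (k + p ^ 4 + 1)) (^-distribˡ-+-* p 4 4) ⟨
    p ^ 4 + (p ^ 8 + p ^ 4 + 1)                                ∎)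
    where
    eq : ∀ q → suc q * suc q ≡ q + (q * q + q + 1)
    eq = solve-∀

goodBlock : ∀ p → 1 < p → GoodBlock p (e₁ p) (e₂ p) (e₃ p)
goodBlock p 1<p with m≤n⇒m<n∨m≡n 1<p
... | inj₁ 2<p  = goodBlock-large 2<p
... | inj₂ refl = record
  { parametrisation = Two.parametrisation
  ; blockSize       = refl
  ; pointCount      = refl
  ; 1<E₁            = m≤m+n 2 5
  ; 1<E₂            = m≤m+n 2 1
  ; 1<E₃            = m≤m+n 2 11
  }

proposition7p9 : (p : ℕ) → 1 < p →
    (∃ λ ƛ → Is2Design (𝒟³ p) (p ^ 8 + p ^ 4 + 1) (p ^ 4 + 1) ƛ) ×
    GridImprimitive₃ (G p) ×
    IsAutomorphismGroup (𝒟³ p) (G p) ×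
    BlockTransitive (𝒟³ p) (G p)
proposition7p9 p 1<p =
  subst₂ (λ v k → ∃ λ ƛ → Is2Design (𝒟³ p) v k ƛ) pointCount blockSize
    (parametrised-design parametrisation (<-trans z<s 1<E₁) (<-trans z<s 1<E₂) (<-trans z<s 1<E₃)) ,
  Sym³-gridImprimitive 1<E₁ 1<E₂ 1<E₃ ,
  𝒟-automorphisms (BaseBlock.B p) (G p) ,
  𝒟-blockTransitive (BaseBlock.B p) (G p)
  where open GoodBlock (goodBlock p 1<p)
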